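{- Let $A$ be a set of actions. Then $\mathsf{Mil}\sim\mathsf{cMil}_1\sim\mathsf{cMil}\sim\mathsf{CLC}$; that is, the proof systems $\mathsf{Mil}$, $\mathsf{cMil}_1$, $\mathsf{cMil}$ and $\mathsf{CLC}$ (over $A$) have the same theorems.
   Context: **Star expressions.** For a set $A$ of actions, the set $StExp(A)$ of star expressions is generated by $e ::= 0\mid 1\mid a\mid (e_1+e_2)\mid (e_1\cdot e_2)\mid e^*$ with $a\in A$. $\sum_{i=1}^n e_i$ is $0$ for $n=0$, $e_1$ for $n=1$, and $(\sum_{i=1}^{n-1}e_i)+e_n$ for $n>1$. $Eq(A)$ is the set of formal equations $e=f$ with $e,f\in StExp(A)$. Immediate termination $e{\downarrow}$ is defined inductively by: $1{\downarrow}$; $(e_1+e_2){\downarrow}$ if $e_1{\downarrow}$ or $e_2{\downarrow}$; $(e_1\cdot e_2){\downarrow}$ if $e_1{\downarrow}$ and $e_2{\downarrow}$; $(e^*){\downarrow}$ always. Write $e{\not\downarrow}$ if $e{\downarrow}$ does not hold. **Proof systems.** An $Eq(A)$-based proof system is a Hilbert-style proof system whose formulas are the equations in $Eq(A)$; $e=_S f$ means that $e=f$ is derivable in $S$ without assumptions (is a theorem of $S$). It is $\mathcal{EL}$-based if its rules include those of equational logic: reflexivity, symmetry, transitivity, and the context rule (from $e=f$ infer $C[e]=C[f]$ for one-hole star expression contexts $C$). $S+\Gamma$ adds the equations in $\Gamma\subseteq Eq(A)$ as axioms to $S$; $S+R$ adds the rule $R$. $S_1\sim S_2$ means that $S_1$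 and $S_2$ have the same theorems. $\mathsf{ACI}$ consists of the axioms $(e+f)+g=e+(f+g)$, $e+f=f+e$, $e+e=e$; $\mathsf{ACI}\sqsubseteq S$ means that all of these are axioms of $S$. $\mathsf{Mil}^-$ is the $\mathcal{EL}$-based system with exactly the rules of equational logic and the axiom schemes: $(e+f)+g=e+(f+g)$, $e+0=e$, $e+f=f+e$, $e+e=e$, $(e\cdot f)\cdot g=e\cdot(f\cdot g)$, $(e+f)\cdot g=e\cdot g+f\cdot g$, $1\cdot e=e$, $e\cdot 1=e$, $0\cdot e=0$, $e^*=1+e\cdot e^*$, $e^*=(1+e)^*$. Milner's system is $\mathsf{Mil}=\mathsf{Mil}^-+\mathrm{RSP}^*$, where $\mathrm{RSP}^*$ is the rule: from $e=f\cdot e+g$ infer $e=f^*\cdot g$, provided $f{\not\downarrow}$. **1-charts and solutions.** A 1-chart is $C=\langle V,A,1,v_s,\to,\downarrow\rangle$ with a finite set $V$ of vertices, a set $A$ of (proper) action labels, an empty-step label $1\notin A$, a start vertex $v_s\in V$, a transition relation $\to\,\subseteq V\times(A\cup\{1\})\times V$, and a set $\downarrow\,\subseteq V$ of vertices with immediate termination. Transitions with label in $A$ are proper; those with label $1$ are 1-transitions. $C$ is weakly guarded if it has no cycle of 1-transitions. For an $\mathcal{EL}$-based system $S$ with $\mathsf{ACI}\sqsubseteq S$, a function $s:V\to StExp(A)$ is an $S$-provable solution of $C$ if for every $v\in V$: $s(v)=_S\tau_C(v)+\sum_{i=1}^n\underline a_i\cdot s(v_i)$, where $v\xrightarrow{\underline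 a_i}v_i$ ($1\le i\le n$, $\underline a_i\in A\cup\{1\}$) is a (possibly redundant) list of all transitions from $v$, and $\tau_C(v)$ is $1$ if $v{\downarrow}$ and $0$ otherwise. Its principal value is $s(v_s)$. **Guarded LLEE-1-charts.** A loop 1-chart is a 1-chart such that (L1) there is an infinite path from the start vertex, (L2) every infinite path from the start vertex returns to it after a positive number of transitions, (L3) immediate termination is only permitted at the start vertex. Its transitions from the start vertex are its loop-entry transitions, all other transitions belong to its body. A loop sub-1-chart of $C$ is a loop 1-chart $L$ that is a sub-1-chart of $C$ with some vertex $v$ of $C$ as start vertex, formed, for a nonempty set $U$ of transitions of $C$ from $v$ (the loop-entry transitions of $L$), by all vertices and transitions on paths that start with a transition in $U$ and continue onward until $v$ is reached again. A multi-step loop elimination of loop sub-1-charts $L_1,\dots,L_n$ ($n\ge1$) from $C$, where their sets of loop-entry transitions are pairwise disjoint and no start vertex of one is in the body of another one, removes all loop-entry transitions of $L_1,\dots,L_n$, and then all vertices and transitions that become unreachable. A run (sequence of multi-steps) from $C$ is successful if it leads to a 1-chart without an infinite path; it is layered if it never removes loop-entry transitions that depart from a vertex in the body of a previously eliminated loop sub-1-chart. A LLEE-witness of $C$ is the labeling of the transitions of $C$ by natural numbers that records a successful layered run: marking label $n\ge1$ for transitions removed as loop-entry transitions in the $n$-th multi-step ('loop-entry transitions'), label $0$ for all other transitions ('body transitions'). It is guarded if all of its loop-entry transitions are proper. A guarded LLEE-1-chart is a 1-chart that has a guarded LLEE-witness. **Coinductive proofs.** Let $S$ be $\mathcal{EL}$-based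 with $\mathsf{ACI}\sqsubseteq S$. A coinductive proof over $S$ of $e_1=e_2$ is a pair $\langle C,L\rangle$ of a weakly guarded 1-chart $C$ with start vertex $v_s$ and a function $L:V(C)\to Eq(A)$, $v\mapsto (L_1(v)=L_2(v))$, such that $L_1$ and $L_2$ are $S$-provable solutions of $C$ and $L_1(v_s)\equiv e_1$, $L_2(v_s)\equiv e_2$ (syntactic equality). It is LLEE-witnessed if $C$ is a guarded LLEE-1-chart. $e_1\overset{\mathrm{LLEE}}{=}_S e_2$ means that there is a LLEE-witnessed coinductive proof over $S$ of $e_1=e_2$. **Coinductive systems.** For $n\in\mathbb N$ (including $0$), the rule $\mathrm{LCoProof}_n$ permits to infer $e=f$ from premises $g_1=h_1,\dots,g_n=h_n$ provided $e\overset{\mathrm{LLEE}}{=}_{\mathsf{Mil}^-+\Gamma}f$ for $\Gamma=\{g_1=h_1,\dots,g_n=h_n\}$. $\mathsf{CLC}$ is the $Eq(A)$-based system without axioms whose rules are exactly all $\mathrm{LCoProof}_n$, $n\in\mathbb N$ (the rules of equational logic are not included). $\mathsf{cMil}$ is $\mathsf{Mil}^-$ extended by all rules $\mathrm{LCoProof}_n$, $n\in\mathbb N$. $\mathsf{cMil}_1$ is $\mathsf{Mil}^-$ extended by only the rule $\mathrm{LCoProof}_1$. -}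

module Defs where

open import Data.Bool.Base using (if_then_else_)
open import Data.Fin.Base using (Fin; toℕ)
open import Data.Fin.Subset using (Subset) renaming (_∈_ to _∈ˢ_)
open import Data.List.Base using (List; []; _∷_; [_]; foldl; map; length; lookup)
open import Data.List.Membership.Propositional using (_∈_)
open import Data.List.NonEmpty.Base using (List⁺; toList)
open import Data.List.Relation.Binary.Disjoint.Propositional using (Disjoint)
open import Data.List.Relation.Unary.All using (All)
open import Data.List.Relation.Unary.AllPairs using (AllPairs)
open import Data.List.Relation.Unary.Any using (Any)
open import Data.Maybe.Base using (Maybe; just; nothing)
open import Data.Nat.Base using (ℕ; suc)
open import Data.Product.Base using (Σ-syntax; ∃-syntax; _×_; _,_)
open import Data.Sum.Base using (_⊎_)
open import Data.Unit.Base using (⊤)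
open import Data.Vec.Base using () renaming (lookup to lookupᵛ)
open import Function.Bundles using (_⇔_)
open import Relation.Binary.Construct.Closure.ReflexiveTransitive using (Star)
open import Relation.Binary.Construct.Closure.Transitive using (TransClosure)
open import Relation.Binary.PropositionalEquality.Core using (_≡_; _≢_)
open import Relation.Nullary.Negation.Core using (¬_)

infixl 6 _+_
infixl 7 _·_
infix  8 _*
infix  5 _≐_
infix  4 _↓ _⊢_ _∼_
infixl 5 _∪_ _⊕_

data StExp (A : Set) : Set where
  𝟘 𝟙 : StExp A
  act : A → StExp A
  _+_ : StExp A → StExp A → StExp A
  _·_ : StExp A → StExp A → StExp A
  _*  : StExp A → StExp A

∑ : {A : Set} → List (StExp A) → StExp A
∑ []       = 𝟘
∑ (e ∷ es) = foldl _+_ e es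

data _↓ {A : Set} : StExp A → Set where
  𝟙↓  : 𝟙 ↓
  +↓ˡ : ∀ {e f} → e ↓ → e + f ↓
  +↓ʳ : ∀ {e f} → f ↓ → e + f ↓
  ·↓  : ∀ {e f} → e ↓ → f ↓ → e · f ↓
  *↓  : ∀ {e} → e * ↓

record Eq (A : Set) : Set where
  constructor _≐_
  field
    lhs rhs : StExp A

open Eq public

data Context (A : Set) : Set where
  □   : Context A
  _+ˡ_ : Context A → StExp A → Context A
  _+ʳ_ : StExp A → Context A → Context A
  _·ˡ_ : Context A → StExp A → Context A
  _·ʳ_ : StExp A → Context A → Context A
  _*ᶜ  : Context A → Context A

plug : {A : Set} → Context A → StExp A → StExp A
plug □        e = e
plug (C +ˡ f) e = plug C e + f
plug (f +ʳ C) e = f + plug C e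
plug (C ·ˡ f) e = plug C e · f
plug (f ·ʳ C) e = f · plug C e
plug (C *ᶜ)   e = plug C e *

-- A system is given by its rule instances: S Γ c means that c may be
-- inferred from the list of premises Γ. Axioms are rules without premises.
System : Set → Set₁
System A = List (Eq A) → Eq A → Set

data _⊢_ {A : Set} (S : System A) : Eq A → Set where
  infer : ∀ {premises conclusion} → S premises conclusion →
          All (S ⊢_) premises → S ⊢ conclusion

_∼_ : {A : Set} → System A → System A → Set
S ∼ T = ∀ c → S ⊢ c ⇔ T ⊢ c

_∪_ : {A : Set} → System A → System A → System A
(S ∪ R) premises c = S premises c ⊎ R premises c

data Axioms {A : Set} (Γ : Eq A → Set) : System A where
  axiom : ∀ {c} → Γ c → Axioms Γ [] c

_⊕_ : {A : Set} → System A → (Eq A → Set) → System A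
S ⊕ Γ = S ∪ Axioms Γ

data EL (A : Set) : System A where
  reflexivity  : ∀ e → EL A [] (e ≐ e)
  symmetry     : ∀ e f → EL A [ e ≐ f ] (f ≐ e)
  transitivity : ∀ e f g → EL A ((e ≐ f) ∷ (f ≐ g) ∷ []) (e ≐ g)
  context      : ∀ C e f → EL A [ e ≐ f ] (plug C e ≐ plug C f)

data Mil⁻-axiom (A : Set) : Eq A → Set where
  +-assoc     : ∀ e f g → Mil⁻-axiom A ((e + f) + g ≐ e + (f + g))
  +-identity  : ∀ e     → Mil⁻-axiom A (e + 𝟘 ≐ e)
  +-comm      : ∀ e f   → Mil⁻-axiom A (e + f ≐ f + e)
  +-idem      : ∀ e     → Mil⁻-axiom A (e + e ≐ e)
  ·-assoc     : ∀ e f g → Mil⁻-axiom A ((e · f) · g ≐ e · (f · g))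
  ·-distribʳ  : ∀ e f g → Mil⁻-axiom A ((e + f) · g ≐ e · g + f · g)
  ·-identityˡ : ∀ e     → Mil⁻-axiom A (𝟙 · e ≐ e)
  ·-identityʳ : ∀ e     → Mil⁻-axiom A (e · 𝟙 ≐ e)
  ·-zeroˡ     : ∀ e     → Mil⁻-axiom A (𝟘 · e ≐ 𝟘)
  *-unfold    : ∀ e     → Mil⁻-axiom A (e * ≐ 𝟙 + e · e *)
  *-𝟙+        : ∀ e     → Mil⁻-axiom A (e * ≐ (𝟙 + e) *)

Mil⁻ : (A : Set) → System A
Mil⁻ A = EL A ⊕ Mil⁻-axiom A

data RSP* (A : Set) : System A where
  rsp* : ∀ e f g → ¬ (f ↓) → RSP* A [ e ≐ f · e + g ] (e ≐ f * · g)

Mil : (A : Set) → System A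
Mil A = Mil⁻ A ∪ RSP* A

-- The label `nothing` is the empty-step label 1.
Label : Set → Set
Label A = Maybe A

record Transition (A V : Set) : Set where
  constructor transition
  field
    source : V
    label  : Label A
    target : V

open Transition public

-- The transition relation is the finite set of the members of
-- `transitions`; the order and multiplicity of the list are irrelevant.
record 1-Chart (A : Set) : Set where
  field
    size        : ℕ
    start       : Fin size
    transitions : List (Transition A (Fin size))
    terminating : Subset size

  Vertex : Set
  Vertex = Fin size

  Tr : Set
  Tr = Transition A Vertex

WeaklyGuarded : {A : Set} → 1-Chart A → Set
WeaklyGuarded C = ∀ v → ¬ TransClosure 1-step v v
  where
  open 1-Chart C
  1-step : Vertex → Vertex → Set
  1-step v w = transition v nothing w ∈ transitions

⟦_⟧ : {A : Set} → Label A → StExp A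
⟦ just a  ⟧ = act a
⟦ nothing ⟧ = 𝟙

-- Used below only for systems S that contain EL and the axioms of
-- associativity, commutativity and idempotence of +, so that the choice of
-- the list of transitions from v is immaterial.
IsProvableSolution : {A : Set} (S : System A) (C : 1-Chart A) →
                     (1-Chart.Vertex C → StExp A) → Set
IsProvableSolution {A} S C s =
  ∀ v → Σ[ ts ∈ List (Label A × Vertex) ]
    (∀ a w → (a , w) ∈ ts ⇔ transition v a w ∈ transitions) ×
    S ⊢ s v ≐ τ v + ∑ (map (λ { (a , w) → ⟦ a ⟧ · s w }) ts)
  where
  open 1-Chart C
  τ : Vertex → StExp A
  τ v = if lookupᵛ terminating v then 𝟙 else 𝟘

module _ {A : Set} (C : 1-Chart A) where
  open 1-Chart C

  -- Candidates for sub-1-charts of C; immediate termination is inherited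
  -- from C. Only those built from `whole` by `generated` and `eliminate` on
  -- actual loops are used, and for these all transitions are transitions of
  -- C between vertices of the candidate.
  record Sub : Set₁ where
    field
      root         : Vertex
      IsVertex     : Vertex → Set
      IsTransition : Tr → Set

    Step : Vertex → Vertex → Set
    Step v w = ∃[ a ] IsTransition (transition v a w)

    IsInfinitePath : (ℕ → Vertex) → Set
    IsInfinitePath p = ∀ i → Step (p i) (p (suc i))

  open Sub

  whole : Sub
  whole = record
    { root         = start
    ; IsVertex     = λ _ → ⊤
    ; IsTransition = _∈ transitions
    }

  record IsLoop (L : Sub) : Set where
    field
      L1 : ∃[ p ] p 0 ≡ root L × IsInfinitePath L p
      L2 : ∀ p → p 0 ≡ root L → IsInfinitePath L p → ∃[ i ] p (suc i) ≡ root L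
      L3 : ∀ v → IsVertex L v → v ∈ˢ terminating → v ≡ root L

  -- The transitions of D on paths that start with a transition in U and
  -- continue until v is reached again (they need not reach v again).
  data OnPath (D : Sub) (v : Vertex) (U : List Tr) : Tr → Set where
    entry  : ∀ {t} → t ∈ U → OnPath D v U t
    onward : ∀ {t t′} → OnPath D v U t → target t ≢ v →
             IsTransition D t′ → source t′ ≡ target t → OnPath D v U t′

  record Loop : Set where
    field
      vertex  : Vertex
      entries : List⁺ Tr

    Entry : Tr → Set
    Entry t = t ∈ toList entries

  open Loop

  generated : Sub → Loop → Sub
  generated D l = record
    { root         = vertex l
    ; IsVertex     = λ w → w ≡ vertex l ⊎ ∃[ t ] OnLoop t × target t ≡ w
    ; IsTransition = OnLoop
    }
    where
    OnLoop : Tr → Set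
    OnLoop = OnPath D (vertex l) (toList (entries l))

  IsLoopSubchart : Sub → Loop → Set
  IsLoopSubchart D l =
    (∀ t → Entry l t → IsTransition D t × source t ≡ vertex l) ×
    IsLoop (generated D l)

  InBody : Sub → Loop → Vertex → Set
  InBody D l w = IsVertex (generated D l) w × w ≢ vertex l

  MultiStep : Set
  MultiStep = List⁺ Loop

  IsMultiStep : Sub → MultiStep → Set
  IsMultiStep D m =
    All (IsLoopSubchart D) (toList m) ×
    AllPairs Disjoint (map (λ l → toList (entries l)) (toList m)) ×
    (∀ l l′ → l ∈ toList m → l′ ∈ toList m → ¬ InBody D l (vertex l′))

  RemovedEntry : MultiStep → Tr → Set
  RemovedEntry m t = Any (λ l → Entry l t) (toList m)

  eliminate : Sub → MultiStep → Sub
  eliminate D m = record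
    { root         = root D
    ; IsVertex     = Reachable
    ; IsTransition = λ t → Kept t × Reachable (source t)
    }
    where
    Kept : Tr → Set
    Kept t = IsTransition D t × ¬ RemovedEntry m t

    Reachable : Vertex → Set
    Reachable = Star (λ v w → ∃[ a ] Kept (transition v a w)) (root D)

  IsRun : Sub → List MultiStep → Set
  IsRun D []      = ⊤
  IsRun D (m ∷ r) = IsMultiStep D m × IsRun (eliminate D m) r

  IsLayered : Sub → List MultiStep → Set
  IsLayered D []      = ⊤
  IsLayered D (m ∷ r) =
    (∀ l m′ l′ → l ∈ toList m → m′ ∈ r → l′ ∈ toList m′ →
       ¬ InBody D l (vertex l′)) ×
    IsLayered (eliminate D m) r

  IsSuccessful : Sub → List MultiStep → Set
  IsSuccessful D r = ¬ (∃[ p ] IsInfinitePath (foldl eliminate D r) p)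

  -- Multi-steps are counted from 1, hence transitions that are not removed
  -- as loop-entry transitions have label 0.
  Records : (Tr → ℕ) → List MultiStep → Set
  Records lab r = ∀ t → t ∈ transitions → ∀ k →
    lab t ≡ suc k ⇔ (Σ[ i ∈ Fin (length r) ] toℕ i ≡ k × RemovedEntry (lookup r i) t)

  IsLLEEWitness : (Tr → ℕ) → Set
  IsLLEEWitness lab = ∃[ r ]
    IsRun whole r × IsLayered whole r × IsSuccessful whole r × Records lab r

  IsGuarded : (Tr → ℕ) → Set
  IsGuarded lab = ∀ t → t ∈ transitions → lab t ≢ 0 → label t ≢ nothing

  IsGuardedLLEE : Set
  IsGuardedLLEE = ∃[ lab ] IsLLEEWitness lab × IsGuarded lab

record CoinductiveProof {A : Set} (S : System A) (c : Eq A) : Set where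
  field
    chart         : 1-Chart A
    weaklyGuarded : WeaklyGuarded chart

  open 1-Chart chart

  field
    equation     : Vertex → Eq A
    lhs-solution : IsProvableSolution S chart (λ v → lhs (equation v))
    rhs-solution : IsProvableSolution S chart (λ v → rhs (equation v))
    principal    : equation start ≡ c

LLEE-Provable : {A : Set} → System A → Eq A → Set
LLEE-Provable S c =
  Σ[ P ∈ CoinductiveProof S c ] IsGuardedLLEE (CoinductiveProof.chart P)

data LCoProof (A : Set) (n : ℕ) : System A where
  lcoproof : ∀ {Γ c} → length Γ ≡ n →
             LLEE-Provable (Mil⁻ A ⊕ (_∈ Γ)) c → LCoProof A n Γ c

CLC : (A : Set) → System A
CLC A Γ c = ∃[ n ] LCoProof A n Γ c

cMil : (A : Set) → System A
cMil A = Mil⁻ A ∪ CLC A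

cMil₁ : (A : Set) → System A
cMil₁ A = Mil⁻ A ∪ LCoProof A 1

{-# OPTIONS --safe #-}
-- Solutions of a guarded LLEE-1-chart are unique in Mil. When a loop at v is eliminated, every
-- vertex in its body takes the value h · s v in any solution s, with h independent of s: by L2
-- the body is well-founded once v is avoided, by L3 it does not terminate, and the loops
-- eliminated earlier are solved by RSP*. After the last elimination the remaining transitions
-- are well-founded, and the same argument shows that two solutions agree.
--
-- Every star expression is the principal value of a solution of a guarded LLEE-1-chart. This
-- chart is built by recursion, with its vertices ordered such that the non-increasing
-- transitions are exactly the loop entries; eliminating the loops in increasing order of their
-- vertices is then a successful layered run. Since the start vertex has no incoming
-- transitions, the value there may be replaced by any provably equal expression, which gives
-- all theorems of Mil⁻ + Γ. For RSP* the chart of f* · g is solved by every X with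
-- X = f · X + g, in particular by e and by f* · g.
module Submission where

open import Defs

open import Algebra.Bundles using (CommutativeSemigroup)
import Algebra.Properties.CommutativeSemigroup as CommutativeSemigroupProperties
open import Data.Bool.Base using (Bool; true; false; if_then_else_; _∧_; _∨_)
open import Data.Fin.Base as Fin using (Fin; zero; suc; toℕ; _↑ˡ_; _↑ʳ_; splitAt)
open import Data.Fin.Induction using (>-wellFounded)
import Data.Fin.Properties as Fin
open import Data.Fin.Subset using () renaming (_∈_ to _∈ˢ_)
open import Data.List.Base
  using (List; []; _∷_; [_]; _++_; map; filter; concatMap; allFin; foldl; length; lookup)
open import Data.List.Membership.Propositional using (_∈_; _∉_; find; lose)
open import Data.List.Membership.Propositional.Properties
  using (∈-map⁺; ∈-map⁻; ∈-++⁺ˡ; ∈-++⁺ʳ; ∈-++⁻; ∈-filter⁺; ∈-filter⁻; ∈-allFin;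
         ∈-concatMap⁺; ∈-concatMap⁻)
open import Data.List.NonEmpty.Base as List⁺ using (toList; _∷_)
import Data.List.Properties as List
open import Data.List.Relation.Unary.All as All using (All; []; _∷_; all?)
open import Data.List.Relation.Unary.All.Properties using (¬All⇒Any¬)
open import Data.List.Relation.Unary.AllPairs using (AllPairs; []; _∷_)
open import Data.List.Relation.Unary.AllPairs.Properties using (tabulate⁺-<)
open import Data.List.Relation.Unary.Any using (Any; here; there; any?)
open import Data.Maybe.Base using (just; nothing)
open import Data.Nat.Base as ℕ using (ℕ; zero; suc)
open import Data.Nat.Induction using (<-wellFounded)
import Data.Nat.Properties as ℕ
open import Data.Product.Base using (Σ-syntax; ∃-syntax; _×_; _,_; proj₁; proj₂; map₁; map₂)
open import Data.Sum.Base using (_⊎_; inj₁; inj₂; [_,_]′)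
open import Data.Unit.Base using (tt)
open import Data.Vec.Base using (tabulate) renaming (lookup to lookupᵛ)
open import Data.Vec.Properties using ([]=⇒lookup; lookup⇒[]=; lookup∘tabulate)
open import Function.Base using (_∘_; id; flip)
open import Function.Bundles using (_⇔_; mk⇔; Equivalence)
open import Induction.WellFounded using (Acc; acc)
open import Relation.Binary.Bundles using (Setoid)
open import Relation.Binary.Construct.Closure.ReflexiveTransitive
  using (Star; ε; _◅_; _◅◅_; gmap)
open import Relation.Binary.Construct.Closure.Transitive as Plus using (TransClosure)
open import Relation.Binary.Definitions using (Decidable)
open import Relation.Binary.PropositionalEquality.Core
  using (_≡_; _≢_; refl; sym; trans; cong; subst; subst₂)
import Relation.Binary.Reasoning.Setoid as SetoidReasoning
open import Relation.Nullary.Decidable using (Dec; yes; no; _×-dec_; ¬?)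
open import Relation.Nullary.Negation.Core using (¬_; contradiction)

-- Derivations and equational reasoning over systems that contain `Mil⁻`.

_⊑_ : {A : Set} → System A → System A → Set
S ⊑ T = ∀ {Γ c} → S Γ c → T Γ c

module _ {A : Set} {S T : System A} where

  mutual
    -- It suffices that each rule of `S` is admissible in `T`, which is the form in which the
    -- coinductive rules are eliminated from `cMil`. The companion `simulateAll` keeps the recursion
    -- structural.
    simulate : (∀ {Γ c} → S Γ c → All (T ⊢_) Γ → T ⊢ c) → ∀ {c} → S ⊢ c → T ⊢ c
    simulate rule (infer r ds) = rule r (simulateAll rule ds)

    simulateAll : (∀ {Γ c} → S Γ c → All (T ⊢_) Γ → T ⊢ c) → ∀ {Γ} → All (S ⊢_) Γ → All (T ⊢_) Γ
    simulateAll rule []       = []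
    simulateAll rule (d ∷ ds) = simulate rule d ∷ simulateAll rule ds

  weaken : S ⊑ T → ∀ {c} → S ⊢ c → T ⊢ c
  weaken S⊑T = simulate (λ r → infer (S⊑T r))

-- The right-nested variant of `∑` suits induction on lists; `∑≈∑⟨⟩` relates the two.
∑⟨_⟩ : {A B : Set} → (B → StExp A) → List B → StExp A
∑⟨ s ⟩ []       = 𝟘
∑⟨ s ⟩ (x ∷ xs) = s x + ∑⟨ s ⟩ xs

module Theory {A : Set} (S : System A) (Mil⁻⊑S : Mil⁻ A ⊑ S) where

  infix 4 _≈_

  _≈_ : StExp A → StExp A → Set
  e ≈ f = S ⊢ e ≐ f

  ≈-axiom : ∀ {e f} → Mil⁻-axiom A (e ≐ f) → e ≈ f
  ≈-axiom ax = infer (Mil⁻⊑S (inj₂ (axiom ax))) []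

  ≈-refl : ∀ {e} → e ≈ e
  ≈-refl {e} = infer (Mil⁻⊑S (inj₁ (reflexivity e))) []

  ≈-sym : ∀ {e f} → e ≈ f → f ≈ e
  ≈-sym {e} {f} d = infer (Mil⁻⊑S (inj₁ (symmetry e f))) (d ∷ [])

  ≈-trans : ∀ {e f g} → e ≈ f → f ≈ g → e ≈ g
  ≈-trans {e} {f} {g} d d′ = infer (Mil⁻⊑S (inj₁ (transitivity e f g))) (d ∷ d′ ∷ [])

  ≈-reflexive : ∀ {e f} → e ≡ f → e ≈ f
  ≈-reflexive refl = ≈-refl

  ≈-context : ∀ C {e f} → e ≈ f → plug C e ≈ plug C f
  ≈-context C {e} {f} d = infer (Mil⁻⊑S (inj₁ (context C e f))) (d ∷ [])

  +-cong : ∀ {e e′ f f′} → e ≈ e′ → f ≈ f′ → e + f ≈ e′ + f′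
  +-cong {e′ = e′} {f = f} d d′ = ≈-trans (≈-context (□ +ˡ f) d) (≈-context (e′ +ʳ □) d′)

  ·-cong : ∀ {e e′ f f′} → e ≈ e′ → f ≈ f′ → e · f ≈ e′ · f′
  ·-cong {e′ = e′} {f = f} d d′ = ≈-trans (≈-context (□ ·ˡ f) d) (≈-context (e′ ·ʳ □) d′)

  *-cong : ∀ {e f} → e ≈ f → e * ≈ f *
  *-cong = ≈-context (□ *ᶜ)

  ≈-setoid : Setoid _ _
  ≈-setoid = record
    { Carrier       = StExp A
    ; _≈_           = _≈_
    ; isEquivalence = record { refl = ≈-refl ; sym = ≈-sym ; trans = ≈-trans }
    }

  +-identityˡ : ∀ e → 𝟘 + e ≈ e
  +-identityˡ e = ≈-trans (≈-axiom (+-comm 𝟘 e)) (≈-axiom (+-identity e))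

  +-commutativeSemigroup : CommutativeSemigroup _ _
  +-commutativeSemigroup = record
    { isCommutativeSemigroup = record
      { isSemigroup = record
        { isMagma = record { isEquivalence = Setoid.isEquivalence ≈-setoid ; ∙-cong = +-cong }
        ; assoc   = λ e f g → ≈-axiom (+-assoc e f g)
        }
      ; comm = λ e f → ≈-axiom (+-comm e f)
      }
    }

  open CommutativeSemigroupProperties +-commutativeSemigroup public
    using () renaming (interchange to +-interchange; x∙yz≈y∙xz to x+yz≈y+xz)
  open SetoidReasoning ≈-setoid public using (begin_; step-≈-⟩; step-≈-⟨; _∎)

  module _ {B : Set} {s : B → StExp A} where

    foldl-∑⟨⟩ : ∀ e xs → foldl _+_ e (map s xs) ≈ e + ∑⟨ s ⟩ xs
    foldl-∑⟨⟩ e []       = ≈-sym (≈-axiom (+-identity e))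
    foldl-∑⟨⟩ e (x ∷ xs) = ≈-trans (foldl-∑⟨⟩ (e + s x) xs) (≈-axiom (+-assoc _ _ _))

    ∑≈∑⟨⟩ : ∀ xs → ∑ (map s xs) ≈ ∑⟨ s ⟩ xs
    ∑≈∑⟨⟩ []       = ≈-refl
    ∑≈∑⟨⟩ (x ∷ xs) = foldl-∑⟨⟩ (s x) xs

    ∑-++ : ∀ xs {ys} → ∑⟨ s ⟩ (xs ++ ys) ≈ ∑⟨ s ⟩ xs + ∑⟨ s ⟩ ys
    ∑-++ []       = ≈-sym (+-identityˡ _)
    ∑-++ (x ∷ xs) = ≈-trans (+-cong ≈-refl (∑-++ xs)) (≈-sym (≈-axiom (+-assoc _ _ _)))

    ∑-·ʳ : ∀ xs e → ∑⟨ s ⟩ xs · e ≈ ∑⟨ (λ x → s x · e) ⟩ xs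
    ∑-·ʳ []       e = ≈-axiom (·-zeroˡ e)
    ∑-·ʳ (x ∷ xs) e = ≈-trans (≈-axiom (·-distribʳ _ _ e)) (+-cong ≈-refl (∑-·ʳ xs e))

    ∑-absorb : ∀ {x xs} → x ∈ xs → s x + ∑⟨ s ⟩ xs ≈ ∑⟨ s ⟩ xs
    ∑-absorb (here refl) =
      ≈-trans (≈-sym (≈-axiom (+-assoc _ _ _))) (+-cong (≈-axiom (+-idem _)) ≈-refl)
    ∑-absorb (there x∈) = ≈-trans (x+yz≈y+xz _ _ _) (+-cong ≈-refl (∑-absorb x∈))

    ∑-⊆ : ∀ {xs ys} → (∀ {x} → x ∈ xs → x ∈ ys) → ∑⟨ s ⟩ xs + ∑⟨ s ⟩ ys ≈ ∑⟨ s ⟩ ys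
    ∑-⊆ {[]}     _  = +-identityˡ _
    ∑-⊆ {x ∷ xs} xs⊆ys = ≈-trans (≈-axiom (+-assoc _ _ _))
      (≈-trans (+-cong ≈-refl (∑-⊆ (xs⊆ys ∘ there))) (∑-absorb (xs⊆ys (here refl))))

    -- Each sum absorbs the other by associativity, commutativity and idempotence. This makes the
    -- choice of a list of transitions immaterial.
    ∑-set : ∀ {xs ys} → (∀ {x} → x ∈ xs → x ∈ ys) → (∀ {x} → x ∈ ys → x ∈ xs) →
            ∑⟨ s ⟩ xs ≈ ∑⟨ s ⟩ ys
    ∑-set xs⊆ys ys⊆xs =
      ≈-trans (≈-sym (∑-⊆ ys⊆xs)) (≈-trans (≈-axiom (+-comm _ _)) (∑-⊆ xs⊆ys))

    ∑-map : ∀ {C : Set} (f : C → B) xs → ∑⟨ s ⟩ (map f xs) ≡ ∑⟨ s ∘ f ⟩ xs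
    ∑-map f []       = refl
    ∑-map f (x ∷ xs) rewrite ∑-map f xs = refl

  ∑-cong : ∀ {B : Set} {s s′ : B → StExp A} xs → (∀ x → s x ≈ s′ x) → ∑⟨ s ⟩ xs ≈ ∑⟨ s′ ⟩ xs
  ∑-cong []       _   = ≈-refl
  ∑-cong (x ∷ xs) s≈s′ = +-cong (s≈s′ x) (∑-cong xs s≈s′)

-- Uniqueness of solutions in Mil

InfinitePathFrom : {V : Set} → (V → V → Set) → V → Set
InfinitePathFrom {V} R x = Σ[ p ∈ (ℕ → V) ] p 0 ≡ x × (∀ i → R (p i) (p (suc i)))

module _ {n : ℕ} {R : Fin n → Fin n → Set} (R? : Decidable R) where

  endless : ∀ {xs} → All (λ x → Any (R x) xs) xs → ∀ {x} → x ∈ xs → InfinitePathFrom R x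
  endless {xs} next x∈ = proj₁ ∘ walk , refl , λ i → proj₂ (proj₂ (find (step i)))
    where
    walk : ℕ → Σ[ x ∈ Fin n ] x ∈ xs
    step : ∀ i → Any (R (proj₁ (walk i))) xs

    walk zero    = _ , x∈
    walk (suc i) = let y , y∈ , _ = find (step i) in y , y∈

    step i = All.lookup next (proj₂ (walk i))

  -- Vertices without successors among the remaining ones are discarded one by one.
  prune : ∀ xs → Acc ℕ._<_ (length xs) → (∀ {y} → y ∉ xs → Acc (flip R) y) →
          ∀ x → Acc (flip R) x ⊎ InfinitePathFrom R x
  prune xs (acc rec) outside x with all? (λ y → any? (R? y) xs) xs
  ... | yes next with any? (x Fin.≟_) xs
  ...   | yes x∈ = inj₂ (endless next x∈)
  ...   | no x∉  = inj₁ (outside x∉)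
  prune xs (acc rec) outside x | no ¬next =
    prune (filter keep? xs) (rec (List.filter-notAll keep? xs dead)) outside′ x
    where
    dead-end : Any (λ y → ¬ Any (R y) xs) xs
    dead-end = ¬All⇒Any¬ (λ y → any? (R? y) xs) xs ¬next

    d : Fin n
    d = proj₁ (find dead-end)

    keep? : ∀ y → Dec (y ≢ d)
    keep? y = ¬? (y Fin.≟ d)

    dead : Any (λ y → ¬ (y ≢ d)) xs
    dead = lose (proj₁ (proj₂ (find dead-end))) (λ d≢d → d≢d refl)

    outside′ : ∀ {y} → y ∉ filter keep? xs → Acc (flip R) y
    outside′ {y} y∉ with y Fin.≟ d
    -- `d` has no successor in `xs`, so each of its successors was discarded earlier and is
    -- accessible.
    ... | yes refl = acc λ Rdz → outside λ z∈ → proj₂ (proj₂ (find dead-end)) (lose z∈ Rdz)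
    ... | no y≢d   = outside λ y∈ → y∉ (∈-filter⁺ keep? y∈ y≢d)

  -- L2 and the success of a run speak about infinite paths. This dichotomy, constructive because
  -- the relation is decidable on a finite set, turns them into well-founded induction.
  accessible-or-infinite : ∀ x → Acc (flip R) x ⊎ InfinitePathFrom R x
  accessible-or-infinite =
    prune (allFin n) (<-wellFounded _) λ y∉ → contradiction (∈-allFin _) y∉

module Uniqueness {A : Set} (C : 1-Chart A) where

  open 1-Chart C
  open Theory (Mil A) inj₁
  open Sub
  open Loop

  step : (Vertex → StExp A) → Tr → StExp A
  step s t = ⟦ label t ⟧ · s (target t)

  outgoing : Vertex → List Tr
  outgoing v = filter (λ t → source t Fin.≟ v) transitions

  τ : Vertex → StExp A
  τ v = if lookupᵛ terminating v then 𝟙 else 𝟘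

  -- The list supplied by the solution is exchanged for `outgoing v`, so that two solutions become
  -- sums over the same transitions.
  unfold : ∀ {s} → IsProvableSolution (Mil A) C s → ∀ v → s v ≈ τ v + ∑⟨ step s ⟩ (outgoing v)
  unfold {s} sol v with sol v
  ... | ts , ts⇔ , eq = ≈-trans eq (+-cong ≈-refl (≈-trans (∑≈∑⟨⟩ ts)
      (≈-trans (∑-set to from) (≈-reflexive (∑-map labelTarget (outgoing v))))))
    where
    labelTarget : Tr → Label A × Vertex
    labelTarget t = label t , target t

    to : ∀ {e} → e ∈ ts → e ∈ map labelTarget (outgoing v)
    to e∈ = ∈-map⁺ labelTarget
      (∈-filter⁺ (λ t → source t Fin.≟ v) (Equivalence.to (ts⇔ _ _) e∈) refl)

    from : ∀ {e} → e ∈ map labelTarget (outgoing v) → e ∈ ts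
    from e∈ with ∈-map⁻ labelTarget e∈
    ... | _ , t∈ , refl with ∈-filter⁻ (λ t → source t Fin.≟ v) t∈
    ... | t∈C , refl = Equivalence.from (ts⇔ _ _) t∈C

  module _ (s₁ s₂ : Vertex → StExp A)
           (sol₁ : IsProvableSolution (Mil A) C s₁) (sol₂ : IsProvableSolution (Mil A) C s₂) where

    -- What `relate` needs of a relation between the values of the two solutions. It is used for
    -- `_≈_`, on the vertices left at the end, and for `Multiple v`, on the bodies of loops at `v`.
    record Compatible (P : StExp A → StExp A → Set) : Set where
      field
        resp : ∀ {e e′ f f′} → e ≈ e′ → f ≈ f′ → P e′ f′ → P e f
        null : P 𝟘 𝟘
        plus : ∀ {e e′ f f′} → P e f → P e′ f′ → P (e + e′) (f + f′)
        left : ∀ h {e f} → P e f → P (h · e) (h · f)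

    ≈-compatible : Compatible _≈_
    ≈-compatible = record
      { resp = λ p q r → ≈-trans p (≈-trans r (≈-sym q))
      ; null = ≈-refl
      ; plus = +-cong
      ; left = λ h → ·-cong ≈-refl
      }

    -- The factor `h` is shared by both solutions. In this way values in a loop body are compared
    -- before the values at `v` are known to agree.
    Multiple : Vertex → StExp A → StExp A → Set
    Multiple v e f = ∃[ h ] e ≈ h · s₁ v × f ≈ h · s₂ v

    multiple-compatible : ∀ v → Compatible (Multiple v)
    multiple-compatible v = record
      { resp = λ { p q (h , eq₁ , eq₂) → h , ≈-trans p eq₁ , ≈-trans q eq₂ }
      ; null = 𝟘 , ≈-sym (≈-axiom (·-zeroˡ _)) , ≈-sym (≈-axiom (·-zeroˡ _))
      ; plus = λ { (h , p , q) (h′ , p′ , q′) → h + h′ , add p p′ , add q q′ }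
      ; left = λ { g (h , p , q) → g · h , mul p , mul q }
      }
      where
      add : ∀ {e e′ h h′ x} → e ≈ h · x → e′ ≈ h′ · x → e + e′ ≈ (h + h′) · x
      add p p′ = ≈-trans (+-cong p p′) (≈-sym (≈-axiom (·-distribʳ _ _ _)))

      mul : ∀ {e g h x} → e ≈ h · x → g · e ≈ (g · h) · x
      mul p = ≈-trans (·-cong ≈-refl p) (≈-sym (≈-axiom (·-assoc _ _ _)))

    multiple-refl : ∀ v → Multiple v (s₁ v) (s₂ v)
    multiple-refl v = 𝟙 , ≈-sym (≈-axiom (·-identityˡ _)) , ≈-sym (≈-axiom (·-identityˡ _))

    -- The exclusion of 1-transitions keeps the summand `⟦ label t ⟧ · h` from terminating, as the
    -- side condition of RSP* demands.
    Returning : Vertex → Tr → Set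
    Returning v t = label t ≢ nothing × Multiple v (s₁ (target t)) (s₂ (target t))

    module _ {P : StExp A → StExp A → Set} (compatible : Compatible P) (v : Vertex) where

      open Compatible compatible

      -- The transitions that return to v contribute to a factor f of s v, the others to g.
      record Split (ts : List Tr) : Set where
        field
          f g₁ g₂  : StExp A
          guarded  : ¬ (f ↓)
          related  : P g₁ g₂
          split₁   : ∑⟨ step s₁ ⟩ ts ≈ f · s₁ v + g₁
          split₂   : ∑⟨ step s₂ ⟩ ts ≈ f · s₂ v + g₂

      split : ∀ ts → (∀ {t} → t ∈ ts → Returning v t ⊎ P (s₁ (target t)) (s₂ (target t))) → Split ts
      split [] _ = record
        { f = 𝟘 ; g₁ = 𝟘 ; g₂ = 𝟘
        ; guarded = λ ()
        ; related = null
        ; split₁  = none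
        ; split₂  = none
        }
        where
        none : ∀ {e} → 𝟘 ≈ 𝟘 · e + 𝟘
        none = ≈-sym (≈-trans (≈-axiom (+-identity _)) (≈-axiom (·-zeroˡ _)))
      split (t ∷ ts) good with good (here refl) | split ts (good ∘ there)
      ... | inj₁ (≢nothing , h , eq₁ , eq₂) | record
        { f = f ; guarded = guarded ; related = related
        ; split₁ = split₁ ; split₂ = split₂ } = record
        { f       = ⟦ label t ⟧ · h + f
        ; guarded = λ { (+↓ˡ (·↓ a↓ _)) → proper-label (label t) ≢nothing a↓
                        ; (+↓ʳ f↓)          → guarded f↓ }
        ; related = related
        ; split₁  = factor eq₁ split₁
        ; split₂  = factor eq₂ split₂
        }
        where
        proper-label : ∀ a → a ≢ nothing → ¬ (⟦ a ⟧ ↓)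
        proper-label nothing ≢nothing _ = ≢nothing refl

        factor : ∀ {a e x y g} → e ≈ h · x → y ≈ f · x + g → a · e + y ≈ (a · h + f) · x + g
        factor {a} {e} {x} {y} {g} p q = begin
          a · e + y                    ≈⟨ +-cong (·-cong ≈-refl p) q ⟩
          a · (h · x) + (f · x + g)    ≈⟨ ≈-axiom (+-assoc _ _ _) ⟨
          (a · (h · x) + f · x) + g    ≈⟨ +-cong (+-cong (≈-axiom (·-assoc _ _ _)) ≈-refl) ≈-refl ⟨
          ((a · h) · x + f · x) + g    ≈⟨ +-cong (≈-axiom (·-distribʳ _ _ _)) ≈-refl ⟨
          (a · h + f) · x + g          ∎
      ... | inj₂ p | record
        { f = f ; guarded = guarded ; related = related
        ; split₁ = split₁ ; split₂ = split₂ } = record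
        { f       = f
        ; guarded = guarded
        ; related = plus (left ⟦ label t ⟧ p) related
        ; split₁  = ≈-trans (+-cong ≈-refl split₁) (x+yz≈y+xz _ _ _)
        ; split₂  = ≈-trans (+-cong ≈-refl split₂) (x+yz≈y+xz _ _ _)
        }

      solve : ∀ {s f g} → IsProvableSolution (Mil A) C s → ¬ (f ↓) →
              ∑⟨ step s ⟩ (outgoing v) ≈ f · s v + g → s v ≈ f * · (g + τ v)
      solve {s} {f} {g} sol f̸↓ eq = infer (inj₂ (rsp* _ _ _ f̸↓)) (unfolded ∷ [])
        where
        unfolded : s v ≈ f · s v + (g + τ v)
        unfolded = begin
          s v                                ≈⟨ unfold sol v ⟩
          τ v + ∑⟨ step s ⟩ (outgoing v)     ≈⟨ ≈-axiom (+-comm _ _) ⟩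
          ∑⟨ step s ⟩ (outgoing v) + τ v     ≈⟨ +-cong eq ≈-refl ⟩
          (f · s v + g) + τ v                ≈⟨ ≈-axiom (+-assoc _ _ _) ⟩
          f · s v + (g + τ v)                ∎

      -- Splitting the transitions from `v` gives both solutions the same factor `f`, hence the same
      -- prefix `f *` after RSP*; what follows this prefix is related by `related` and `Pτ`.
      relate : P (τ v) (τ v) →
               (∀ {t} → t ∈ transitions → source t ≡ v →
                Returning v t ⊎ P (s₁ (target t)) (s₂ (target t))) →
               P (s₁ v) (s₂ v)
      relate Pτ good = resp (solve sol₁ guarded split₁) (solve sol₂ guarded split₂)
                            (left (f *) (plus related Pτ))
        where
        good′ : ∀ {t} → t ∈ outgoing v → Returning v t ⊎ P (s₁ (target t)) (s₂ (target t))
        good′ t∈ = let t∈C , s≡v = ∈-filter⁻ (λ t → source t Fin.≟ v) t∈ in good t∈C s≡v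

        open Split (split (outgoing v) good′)

    module _ (lab : Tr → ℕ) (lab-guarded : IsGuarded C lab) where

      Removed : ℕ → Tr → Set
      Removed k t = lab t ≢ 0 × lab t ℕ.≤ k

      removed? : ∀ k t → Dec (Removed k t)
      removed? k t = ¬? (lab t ℕ.≟ 0) ×-dec lab t ℕ.≤? k

      Remaining : ℕ → Vertex → Vertex → Set
      Remaining k u x = Any (λ t → source t ≡ u × target t ≡ x × ¬ Removed k t) transitions

      remaining? : ∀ k → Decidable (Remaining k)
      remaining? k u x =
        any? (λ t → source t Fin.≟ u ×-dec target t Fin.≟ x ×-dec ¬? (removed? k t)) transitions

      -- Since membership in A need not be decidable, the removed transitions are recognised
      -- by their labels.
      record Stage (D : Sub C) (k : ℕ) : Set where
        field
          root≡      : root D ≡ start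
          sound      : ∀ {t} → IsTransition D t → t ∈ transitions × ¬ Removed k t
          from-start : ∀ {t} → t ∈ transitions → ¬ Removed k t → source t ≡ start → IsTransition D t
          onwards    : ∀ {t t′} → IsTransition D t → t′ ∈ transitions → ¬ Removed k t′ →
                       source t′ ≡ target t → IsTransition D t′
          returning  : ∀ {t} → t ∈ transitions → Removed k t → Returning (source t) t

      open Stage

      stage-whole : Stage (whole C) 0
      stage-whole = record
        { root≡      = refl
        ; sound      = λ t∈ → t∈ , nothing-removed
        ; from-start = λ t∈ _ _ → t∈
        ; onwards    = λ _ t∈ _ _ → t∈
        ; returning  = λ _ rm → contradiction rm nothing-removed
        }
        where
        nothing-removed : ∀ {t} → ¬ Removed 0 t
        nothing-removed (≢0 , ≤0) = ≢0 (ℕ.n≤0⇒n≡0 ≤0)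

      module _ {D k} (stage : Stage D k) where

        classify : ∀ {v t} {P : Set} → t ∈ transitions → source t ≡ v → (¬ Removed k t → P) →
                   Returning v t ⊎ P
        classify {t = t} t∈ refl rest with removed? k t
        ... | yes rm = inj₁ (returning stage t∈ rm)
        ... | no ¬rm = inj₂ (rest ¬rm)

        module _ (l : Loop C) (subchart : IsLoopSubchart C D l) where

          v : Vertex
          v = vertex l

          open IsLoop (proj₂ subchart)

          OnLoop : Tr → Set
          OnLoop = OnPath C D v (toList (entries l))

          onLoop-transition : ∀ {t} → OnLoop t → IsTransition D t
          onLoop-transition (entry t∈)         = proj₁ (proj₁ subchart _ t∈)
          onLoop-transition (onward _ _ t∈D _) = t∈D

          Avoiding : Vertex → Vertex → Set
          Avoiding u x = Remaining k u x × x ≢ v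

          avoiding? : Decidable Avoiding
          avoiding? u x = remaining? k u x ×-dec ¬? (x Fin.≟ v)

          -- Preceded by `v`, an infinite path from `target t` that avoids `v` would be an infinite
          -- path of the loop that never returns, against L2.
          no-infinite-detour : ∀ {t} → Entry l t → target t ≢ v →
                               ¬ InfinitePathFrom Avoiding (target t)
          no-infinite-detour {t} t∈ t≢v (p , p0≡ , path) =
            let i , p≡v = L2 q refl q-path in avoids i p≡v
            where
            q : ℕ → Vertex
            q zero    = v
            q (suc i) = p i

            avoids : ∀ i → p i ≢ v
            avoids zero    p≡v = t≢v (trans (sym p0≡) p≡v)
            avoids (suc i)     = proj₂ (path i)

            -- `arrives` and `follow` show together that the path stays in the loop: a remaining
            -- transition that leaves a loop vertex other than `v` belongs to the loop.
            arrives : ∀ i → ∃[ e ] OnLoop e × target e ≡ p i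
            follow  : ∀ i → ∃[ e ] OnLoop e × source e ≡ p i × target e ≡ p (suc i)

            arrives zero    = t , entry t∈ , sym p0≡
            arrives (suc i) = let e , on , _ , tgt≡ = follow i in e , on , tgt≡

            follow i with arrives i | find (proj₁ (path i))
            ... | e , on , tgt≡ | e′ , e′∈ , src′≡ , tgt′≡ , ¬rm =
              e′ , onward on (avoids i ∘ trans (sym tgt≡))
                     (onwards stage (onLoop-transition on) e′∈ ¬rm src≡) src≡ , src′≡ , tgt′≡
              where
              src≡ : source e′ ≡ target e
              src≡ = trans src′≡ (sym tgt≡)

            step-of : ∀ {e x y} → OnLoop e → source e ≡ x → target e ≡ y →
                      ∃[ a ] OnLoop (transition x a y)
            step-of on refl refl = _ , on

            q-path : IsInfinitePath (generated C D l) q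
            q-path zero    = step-of (entry t∈) (proj₂ (proj₁ subchart _ t∈)) (sym p0≡)
            q-path (suc i) = let _ , on , src≡ , tgt≡ = follow i in step-of on src≡ tgt≡

          -- Well-founded induction over paths that avoid `v`. At a body vertex L3 makes the
          -- constant 𝟘, transitions removed earlier return to that vertex, and the remaining ones
          -- lead to `v` or to a body vertex covered by the induction.
          body-multiple : ∀ {t} → OnLoop t → target t ≢ v → Acc (flip Avoiding) (target t) →
                          Multiple v (s₁ (target t)) (s₂ (target t))
          body-multiple {t} on t≢v (acc rs) =
            relate (multiple-compatible v) (target t) τ-multiple λ t′∈ src≡ →
              classify t′∈ src≡ λ ¬rm → next t′∈ src≡ ¬rm
            where
            open Compatible (multiple-compatible v)

            τ-multiple : Multiple v (τ (target t)) (τ (target t))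
            τ-multiple with lookupᵛ terminating (target t) in eq
            ... | false = null
            ... | true  = contradiction
              (L3 (target t) (inj₂ (t , on , refl)) (lookup⇒[]= (target t) terminating eq)) t≢v

            next : ∀ {t′} → t′ ∈ transitions → source t′ ≡ target t → ¬ Removed k t′ →
                   Multiple v (s₁ (target t′)) (s₂ (target t′))
            next {t′} t′∈ src≡ ¬rm with target t′ Fin.≟ v
            ... | yes refl = multiple-refl v
            ... | no t′≢v  = body-multiple
              (onward on t≢v (onwards stage (onLoop-transition on) t′∈ ¬rm src≡) src≡) t′≢v
              (rs (lose t′∈ (src≡ , refl , ¬rm) , t′≢v))

          entry-multiple : ∀ {t} → Entry l t → Multiple (source t) (s₁ (target t)) (s₂ (target t))
          entry-multiple {t} t∈ with proj₂ (proj₁ subchart t t∈) | target t Fin.≟ v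
          ... | refl | yes refl = multiple-refl v
          ... | refl | no t≢v with accessible-or-infinite avoiding? (target t)
          ...   | inj₁ access = body-multiple (entry t∈) t≢v access
          ...   | inj₂ path   = contradiction path (no-infinite-detour t∈ t≢v)

        module _ {m : MultiStep C} (multiStep : IsMultiStep C D m)
                 (recorded : ∀ {t} → t ∈ transitions → lab t ≡ suc k ⇔ RemovedEntry C m t) where

          weaken-removed : ∀ {t} → Removed k t → Removed (suc k) t
          weaken-removed (≢0 , ≤k) = ≢0 , ℕ.m≤n⇒m≤1+n ≤k

          removed-now : ∀ {t} → t ∈ transitions → RemovedEntry C m t → Removed (suc k) t
          removed-now t∈ rm with Equivalence.from (recorded t∈) rm
          ... | lab≡ = (λ ≡0 → ℕ.0≢1+n (trans (sym ≡0) lab≡)) , ℕ.≤-reflexive lab≡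

          kept : ∀ {t} → IsTransition D t → ¬ RemovedEntry C m t → ¬ Removed (suc k) t
          kept t∈D ¬rm (≢0 , ≤1+k) with sound stage t∈D | ℕ.m≤n⇒m<n∨m≡n ≤1+k
          ... | _ , ¬old | inj₁ <1+k = ¬old (≢0 , ℕ.≤-pred <1+k)
          ... | t∈ , _  | inj₂ ≡1+k = ¬rm (Equivalence.to (recorded t∈) ≡1+k)

          -- The entries of `m` are exactly the transitions with label `suc k`, so removal by `m`
          -- and removal by label stay in step. The newly removed transitions return by
          -- `entry-multiple` and are proper by guardedness.
          next-stage : Stage (eliminate C D m) (suc k)
          next-stage = record
            { root≡      = root≡ stage
            ; sound      = λ { ((t∈D , ¬rm) , _) → proj₁ (sound stage t∈D) , kept t∈D ¬rm }
            ; from-start = λ { t∈ ¬rm refl →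
                ( from-start stage t∈ (¬rm ∘ weaken-removed) refl
                , (λ now → ¬rm (removed-now t∈ now)) ) ,
                subst (λ r → Star KeptStep r start) (sym (root≡ stage)) ε }
            ; onwards    = λ { ((t∈D , ¬rmD) , reach) t′∈ ¬rm refl →
                ( onwards stage t∈D t′∈ (¬rm ∘ weaken-removed) refl
                , (λ now → ¬rm (removed-now t′∈ now)) ) ,
                reach ◅◅ ((_ , t∈D , ¬rmD) ◅ ε) }
            ; returning  = λ t∈ (≢0 , ≤1+k) →
                lab-guarded _ t∈ ≢0 , multiple t∈ ≢0 (ℕ.m≤n⇒m<n∨m≡n ≤1+k)
            }
            where
            KeptStep : Vertex → Vertex → Set
            KeptStep x y = ∃[ a ] IsTransition D (transition x a y) ×
                                  ¬ RemovedEntry C m (transition x a y)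

            multiple : ∀ {t} → t ∈ transitions → lab t ≢ 0 → lab t ℕ.< suc k ⊎ lab t ≡ suc k →
                       Multiple (source t) (s₁ (target t)) (s₂ (target t))
            multiple t∈ ≢0 (inj₁ <1+k) = proj₂ (returning stage t∈ (≢0 , ℕ.≤-pred <1+k))
            multiple t∈ ≢0 (inj₂ ≡1+k) with find (Equivalence.to (recorded t∈) ≡1+k)
            ... | l , l∈ , t∈l = entry-multiple l (All.lookup (proj₁ multiStep) l∈) t∈l

      -- Labels count from the start of the whole run: after `k` multi-steps, the one at position
      -- `i` of the rest has label `suc (k ℕ.+ toℕ i)`.
      stage-run : ∀ {D k} r → Stage D k → IsRun C D r →
                  (∀ {t} → t ∈ transitions → ∀ i →
                   lab t ≡ suc (k ℕ.+ toℕ i) ⇔ RemovedEntry C (lookup r i) t) →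
                  ∃[ k′ ] Stage (foldl (eliminate C) D r) k′
      stage-run []      stage _                _        = _ , stage
      stage-run {k = k} (m ∷ r) stage (multiStep , run) recorded =
        stage-run r
          (next-stage stage multiStep λ {t} t∈ →
            subst (λ j → lab t ≡ suc j ⇔ RemovedEntry C m t) (ℕ.+-identityʳ k) (recorded t∈ zero))
          run λ {t} t∈ i →
            subst (λ j → lab t ≡ suc j ⇔ RemovedEntry C (lookup r i) t) (ℕ.+-suc k (toℕ i))
              (recorded t∈ (suc i))

      module _ {D k} (stage : Stage D k) (finite : ¬ (∃[ p ] IsInfinitePath D p)) where

        -- `from-start` and `onwards` supply transitions of `D` only at vertices already reached in
        -- `D`, so the arguments below carry this information along.
        Visited : Vertex → Set
        Visited u = u ≡ start ⊎ ∃[ t ] IsTransition D t × target t ≡ u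

        leave : ∀ {t u} → Visited u → t ∈ transitions → ¬ Removed k t → source t ≡ u →
                IsTransition D t
        leave (inj₁ refl)             t∈ ¬rm src≡ = from-start stage t∈ ¬rm src≡
        leave (inj₂ (_ , t′∈D , refl)) t∈ ¬rm src≡ = onwards stage t′∈D t∈ ¬rm src≡

        -- Induction along the remaining transitions: removed transitions from `u` return to `u`,
        -- and the others lead to vertices where the solutions already agree.
        agree : ∀ {u} → Visited u → Acc (flip (Remaining k)) u → s₁ u ≈ s₂ u
        agree {u} visited (acc rs) = relate ≈-compatible u ≈-refl λ t∈ src≡ →
          classify stage t∈ src≡ λ ¬rm →
            agree (inj₂ (_ , leave visited t∈ ¬rm src≡ , refl)) (rs (lose t∈ (src≡ , refl , ¬rm)))

        no-infinite-path : ¬ InfinitePathFrom (Remaining k) start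
        no-infinite-path (p , p0≡ , path) = finite (p , λ i → follow i (visited i))
          where
          follow : ∀ i → Visited (p i) → ∃[ a ] IsTransition D (transition (p i) a (p (suc i)))
          follow i visited with find (path i)
          ... | t , t∈ , src≡ , tgt≡ , ¬rm = at src≡ tgt≡ (leave visited t∈ ¬rm src≡)
            where
            at : ∀ {x y} → source t ≡ x → target t ≡ y → IsTransition D t →
                 ∃[ a ] IsTransition D (transition x a y)
            at refl refl t∈D = _ , t∈D

          visited : ∀ i → Visited (p i)
          visited zero    = inj₁ p0≡
          visited (suc i) = inj₂ (_ , proj₂ (follow i (visited i)) , refl)

        agree-start : s₁ start ≈ s₂ start
        agree-start with accessible-or-infinite (remaining? k) start
        ... | inj₁ access = agree (inj₁ refl) access
        ... | inj₂ path   = contradiction path no-infinite-path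

    unique : IsGuardedLLEE C → s₁ start ≈ s₂ start
    unique (lab , (r , run , _ , successful , records) , lab-guarded) =
      agree-start lab lab-guarded
        (proj₂ (stage-run lab lab-guarded r (stage-whole lab lab-guarded) run recorded)) successful
      where
      recorded : ∀ {t} → t ∈ transitions → ∀ i →
                 lab t ≡ suc (toℕ i) ⇔ RemovedEntry C (lookup r i) t
      recorded {t} t∈ i = mk⇔ to λ rm → Equivalence.from (records t t∈ (toℕ i)) (i , refl , rm)
        where
        to : lab t ≡ suc (toℕ i) → RemovedEntry C (lookup r i) t
        to lab≡ with Equivalence.to (records t t∈ (toℕ i)) lab≡
        ... | j , j≡i , rm with Fin.toℕ-injective j≡i
        ... | refl = rm

-- Guarded LLEE-witnesses from vertex numberings

module _ {A : Set} (C : 1-Chart A) where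
  open 1-Chart C

  ForwardStep : Vertex → Vertex → Set
  ForwardStep v w = ∃[ a ] transition v a w ∈ transitions × v Fin.< w

  -- The vertices are numbered such that the transitions that do not increase the number
  -- are the loop entries, and the loops at v occupy vertices just before v.
  record IsLayout : Set where
    field
      -- Eliminations remove only non-increasing transitions, so increasing paths survive all of
      -- them and no vertex becomes unreachable.
      reachable : ∀ v → Star ForwardStep start v
      1-forward : ∀ {v w} → transition v nothing w ∈ transitions → v Fin.< w
      -- Non-termination inside the block gives L3; the bound by `v` keeps a loop from being left
      -- other than through `v`.
      block     : ∀ {v a w u} → transition v a w ∈ transitions → w Fin.≤ v →
                  w Fin.≤ u → u Fin.< v →
                  ¬ (u ∈ˢ terminating) ×
                  (∀ {b x} → transition u b x ∈ transitions → x Fin.≤ v)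
      -- One loop entry with a way back to `v` suffices for L1.
      cycle     : ∀ {v a w} → transition v a w ∈ transitions → w Fin.≤ v →
                  ∃[ b ] ∃[ x ] transition v b x ∈ transitions × x Fin.≤ v × Star ForwardStep x v

module Elimination {A : Set} {C : 1-Chart A} (layout : IsLayout C) where
  open 1-Chart C
  open IsLayout layout
  open Loop
  open Sub

  Backward : Tr → Set
  Backward t = target t Fin.≤ source t

  backwardFrom? : ∀ v t → Dec (source t ≡ v × Backward t)
  backwardFrom? v t = source t Fin.≟ v ×-dec target t Fin.≤? source t

  backwardFrom : Vertex → List Tr
  backwardFrom v = filter (backwardFrom? v) transitions

  record MaximalLoop : Set where
    constructor maximal
    field
      loop      : Loop C
      entries≡ : toList (entries loop) ≡ backwardFrom (vertex loop)

    at : Vertex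
    at = vertex loop

    entry⁻ : ∀ {t} → Entry loop t → t ∈ transitions × source t ≡ at × Backward t
    entry⁻ t∈ = ∈-filter⁻ (backwardFrom? at) (subst (_ ∈_) entries≡ t∈)

    entry⁺ : ∀ {t} → t ∈ transitions → source t ≡ at → Backward t → Entry loop t
    entry⁺ t∈ s≡ back = subst (_ ∈_) (sym entries≡) (∈-filter⁺ (backwardFrom? at) t∈ (s≡ , back))

  open MaximalLoop

  Sorted : List MaximalLoop → Set
  Sorted = AllPairs (λ l l′ → at l Fin.< at l′)

  -- A vertex without backward transitions carries no loop. The list `ts` is tied to
  -- `backwardFrom v` by an equation so that this case can be found by matching.
  addLoop : ∀ v ts → ts ≡ backwardFrom v → List MaximalLoop → List MaximalLoop
  addLoop v []       eq ls = ls
  addLoop v (t ∷ ts) eq ls = maximal (record { vertex = v ; entries = t ∷ ts }) eq ∷ ls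

  module _ {v : Vertex} where

    addLoop-> : ∀ {u : Vertex} {ts eq ls} → u Fin.< v → All (λ l → u Fin.< at l) ls →
                All (λ l → u Fin.< at l) (addLoop v ts eq ls)
    addLoop-> {ts = []}    _   u<ls = u<ls
    addLoop-> {ts = _ ∷ _} u<v u<ls = u<v ∷ u<ls

    addLoop-sorted : ∀ {ts eq ls} → All (λ l → v Fin.< at l) ls → Sorted ls →
                     Sorted (addLoop v ts eq ls)
    addLoop-sorted {[]}    _    sorted = sorted
    addLoop-sorted {_ ∷ _} v<ls sorted = v<ls ∷ sorted

    addLoop-here : ∀ {t ts eq ls} → t ∈ ts → v ∈ map at (addLoop v ts eq ls)
    addLoop-here {ts = _ ∷ _} _ = here refl

    addLoop-there : ∀ {ts eq ls u} → u ∈ map at ls → u ∈ map at (addLoop v ts eq ls)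
    addLoop-there {[]}    u∈ = u∈
    addLoop-there {_ ∷ _} u∈ = there u∈

  loopsAt : List Vertex → List MaximalLoop
  loopsAt []       = []
  loopsAt (v ∷ vs) = addLoop v (backwardFrom v) refl (loopsAt vs)

  loopsAt-> : ∀ {v : Vertex} {vs} → All (v Fin.<_) vs → All (λ l → v Fin.< at l) (loopsAt vs)
  loopsAt-> []           = []
  loopsAt-> (v<w ∷ v<vs) = addLoop-> v<w (loopsAt-> v<vs)

  loopsAt-sorted : ∀ {vs} → AllPairs Fin._<_ vs → Sorted (loopsAt vs)
  loopsAt-sorted []              = []
  loopsAt-sorted (v<vs ∷ sorted) = addLoop-sorted (loopsAt-> v<vs) (loopsAt-sorted sorted)

  loopsAt-complete : ∀ {t} → t ∈ transitions → Backward t → ∀ {vs} → source t ∈ vs →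
                     source t ∈ map at (loopsAt vs)
  loopsAt-complete t∈ back {v ∷ _} (here refl) =
    addLoop-here (∈-filter⁺ (backwardFrom? v) t∈ (refl , back))
  loopsAt-complete t∈ back {v ∷ _} (there s∈) = addLoop-there (loopsAt-complete t∈ back s∈)

  loops : List MaximalLoop
  loops = loopsAt (allFin size)

  single : MaximalLoop → MultiStep C
  single l = List⁺.[ loop l ]

  Kept : List MaximalLoop → Tr → Set
  Kept ls t = source t Fin.< target t ⊎ source t ∈ map at ls

  -- `ls` lists the loops still to be eliminated. By `reachable`, an elimination discards nothing
  -- but loop entries, so `D` has exactly the transitions described by `Kept`.
  record Stage (D : Sub C) (ls : List MaximalLoop) : Set where
    field
      root≡    : root D ≡ start
      sound    : ∀ {t} → IsTransition D t → t ∈ transitions × Kept ls t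
      complete : ∀ {t} → t ∈ transitions → Kept ls t → IsTransition D t

  open Stage

  stage-whole : Stage (whole C) loops
  stage-whole = record
    { root≡    = refl
    ; sound    = λ {t} t∈ → t∈ , kept t∈ (target t Fin.≤? source t)
    ; complete = λ t∈ _ → t∈
    }
    where
    kept : ∀ {t} → t ∈ transitions → Dec (Backward t) → Kept loops t
    kept t∈ (yes back) = inj₂ (loopsAt-complete t∈ back (∈-allFin _))
    kept t∈ (no ¬back) = inj₁ (ℕ.≰⇒> ¬back)

  later : ∀ {l ls v} → All (λ l′ → at l Fin.< at l′) ls → v ∈ map at ls → at l Fin.< v
  later l<ls v∈ with _ , l′∈ , refl ← ∈-map⁻ at v∈ = All.lookup l<ls l′∈

  module Eliminate {D l ls} (stage : Stage D (l ∷ ls))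
                   (l<ls : All (λ l′ → at l Fin.< at l′) ls) where

    v : Vertex
    v = at l

    L : Sub C
    L = generated C D (loop l)

    -- The union of the intervals from the targets of loop entries up to `v`. It contains the body
    -- of the loop, and `block` applies to it directly.
    Body : Vertex → Set
    Body u = ∃[ a ] ∃[ w ] transition v a w ∈ transitions × w Fin.≤ u × u Fin.< v

    -- Loops are eliminated in increasing order, so those that remain start at `v` or later, and no
    -- backward transition is left in the interval below `v`.
    body-forward : ∀ {t} → Body (source t) → IsTransition D t → source t Fin.< target t
    body-forward (_ , _ , _ , _ , u<v) t∈D with sound stage t∈D
    ... | _ , inj₁ fwd          = fwd
    ... | _ , inj₂ (here refl)  = contradiction u<v (ℕ.<-irrefl refl)
    ... | _ , inj₂ (there u∈ls) = contradiction u<v (ℕ.<-asym (later {l} l<ls u∈ls))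

    classify : ∀ {w} → w Fin.≤ v → (w Fin.< v → Body w) → w ≡ v ⊎ Body w
    classify {w} w≤v body with w Fin.≟ v
    ... | yes w≡v = inj₁ w≡v
    ... | no w≢v  = inj₂ (body (Fin.≤∧≢⇒< w≤v w≢v))

    -- `block` bounds the targets by `v` from above, and `body-forward` keeps them above the lower
    -- end of the interval.
    onPath-target : ∀ {t} → OnPath C D v (toList (entries (loop l))) t →
                    target t ≡ v ⊎ Body (target t)
    onPath-target (entry t∈) with entry⁻ l t∈
    ... | t∈C , refl , back = classify back λ w<v → _ , _ , t∈C , ℕ.≤-refl , w<v
    onPath-target (onward {t′ = t′} on t≢v t′∈D src≡) with onPath-target on
    ... | inj₁ t≡v = contradiction t≡v t≢v
    ... | inj₂ body with subst Body (sym src≡) body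
    ... | body′@(_ , _ , e∈C , w≤u , u<v) =
      classify (proj₂ (block e∈C (ℕ.≤-trans w≤u (ℕ.<⇒≤ u<v)) w≤u u<v) (proj₁ (sound stage t′∈D)))
        λ x<v → _ , _ , e∈C , ℕ.≤-trans w≤u (ℕ.<⇒≤ (body-forward body′ t′∈D)) , x<v

    onPath-forward : ∀ {t} → OnPath C D v (toList (entries (loop l))) t → source t ≢ v →
                     source t Fin.< target t
    onPath-forward (entry t∈) s≢v = contradiction (proj₁ (proj₂ (entry⁻ l t∈))) s≢v
    onPath-forward (onward {t′ = t′} on t≢v t′∈D src≡) _ with onPath-target on
    ... | inj₁ t≡v  = contradiction t≡v t≢v
    ... | inj₂ body = body-forward (subst Body (sym src≡) body) t′∈D

    inBody : ∀ {w} → InBody C D (loop l) w → Body w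
    inBody (inj₁ w≡v , w≢v) = contradiction w≡v w≢v
    inBody (inj₂ (_ , on , refl) , w≢v) with onPath-target on
    ... | inj₁ w≡v  = contradiction w≡v w≢v
    ... | inj₂ body = body

    body<v : ∀ {w} → InBody C D (loop l) w → w Fin.< v
    body<v w∈ with inBody w∈
    ... | _ , _ , _ , _ , w<v = w<v

    OnLoop : Tr → Set
    OnLoop = OnPath C D v (toList (entries (loop l)))

    -- A position on a cycle through v together with the rest of the way back to v.
    record Position : Set where
      constructor position
      field
        {current} : Vertex
        arrived   : current ≡ v ⊎ ∃[ t ] OnLoop t × target t ≡ current
        return    : Star (ForwardStep C) current v

    open Position

    star-≤ : ∀ {x y} → Star (ForwardStep C) x y → x Fin.≤ y
    star-≤ ε                       = ℕ.≤-refl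
    star-≤ ((_ , _ , x<z) ◅ path) = ℕ.≤-trans (ℕ.<⇒≤ x<z) (star-≤ path)

    firstEntry : ∃[ t ] Entry (loop l) t
    firstEntry = _ , here refl

    -- While a way back remains, its next forward step is taken. Once it is used up, the position is
    -- `v`, and `cycle` supplies a fresh entry with a new way back.
    advance : (p : Position) → Σ[ q ∈ Position ] Step L (current p) (current q)
    advance (position _ ε) with firstEntry
    ... | _ , t∈ with entry⁻ l t∈
    ... | t∈C , refl , back with cycle t∈C back
    ... | b , x , x∈C , x≤v , path =
      position (inj₂ (_ , on , refl)) path , b , on
      where
      on : OnLoop (transition v b x)
      on = entry (entry⁺ l x∈C refl x≤v)
    advance (position (inj₁ refl) ((_ , _ , v<x) ◅ path)) =
      contradiction (star-≤ path) (ℕ.<⇒≱ v<x)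
    advance (position (inj₂ (_ , on , refl)) ((b , x∈C , u<x) ◅ path)) =
      position (inj₂ (_ , on′ , refl)) path , b , on′
      where
      on′ : OnLoop (transition _ b _)
      on′ = onward on (λ u≡v → ℕ.<-irrefl (cong toℕ u≡v) (ℕ.<-≤-trans u<x (star-≤ path)))
              (complete stage x∈C (inj₁ u<x)) refl

    tour : ℕ → Position
    tour zero    = position (inj₁ refl) ε
    tour (suc i) = proj₁ (advance (tour i))

    -- As long as `v` is avoided, loop transitions increase the vertex number, which is possible
    -- only finitely often.
    returns : ∀ p → IsInfinitePath L p → ∀ i → Acc Fin._>_ (p (suc i)) → ∃[ j ] p (suc j) ≡ v
    returns p path i (acc rs) with p (suc i) Fin.≟ v
    ... | yes p≡v = i , p≡v
    ... | no p≢v  = returns p path (suc i) (rs (onPath-forward (proj₂ (path (suc i))) p≢v))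

    isLoop : IsLoop C L
    isLoop = record
      { L1 = (λ i → current (tour i)) , refl , (λ i → proj₂ (advance (tour i)))
      ; L2 = λ p _ path → returns p path 0 (>-wellFounded (p 1))
      ; L3 = L3′
      }
      where
      L3′ : ∀ w → IsVertex L w → w ∈ˢ terminating → w ≡ v
      L3′ w w∈L w∈↓ with w Fin.≟ v
      ... | yes w≡v = w≡v
      ... | no w≢v with inBody (w∈L , w≢v)
      ... | _ , _ , e∈C , x≤w , w<v =
        contradiction w∈↓ (proj₁ (block e∈C (ℕ.≤-trans x≤w (ℕ.<⇒≤ w<v)) x≤w w<v))

    isMultiStep : IsMultiStep C D (single l)
    isMultiStep =
      ((λ t t∈ → let t∈C , s≡v , _ = entry⁻ l t∈ in
                  complete stage t∈C (inj₂ (here s≡v)) , s≡v) , isLoop) ∷ [] ,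
      [] ∷ [] ,
      λ { _ _ (here refl) (here refl) (_ , v≢v) → v≢v refl }

    removed⁻ : ∀ {t} → RemovedEntry C (single l) t → source t ≡ v × Backward t
    removed⁻ (here t∈) = proj₂ (entry⁻ l t∈)

    kept⁺ : ∀ {t} → t ∈ transitions → Kept ls t → IsTransition D t × ¬ RemovedEntry C (single l) t
    kept⁺ t∈C (inj₁ fwd) =
      complete stage t∈C (inj₁ fwd) , λ rm → ℕ.<⇒≱ fwd (proj₂ (removed⁻ rm))
    kept⁺ t∈C (inj₂ s∈) =
      complete stage t∈C (inj₂ (there s∈)) ,
      λ rm → ℕ.<-irrefl (cong toℕ (sym (proj₁ (removed⁻ rm)))) (later {l} l<ls s∈)

    next : Stage (eliminate C D (single l)) ls
    next = record
      { root≡    = root≡ stage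
      ; sound    = λ { ((t∈D , ¬rm) , _) → sound′ (sound stage t∈D) ¬rm }
      ; complete = λ t∈C kept → kept⁺ t∈C kept ,
          subst (λ r → Star KeptStep r _) (sym (root≡ stage))
            (gmap id (λ { (a , t∈C , fwd) → a , kept⁺ t∈C (inj₁ fwd) }) (reachable _))
      }
      where
      KeptStep : Vertex → Vertex → Set
      KeptStep x y = ∃[ a ] IsTransition D (transition x a y) ×
                            ¬ RemovedEntry C (single l) (transition x a y)

      sound′ : ∀ {t} → t ∈ transitions × Kept (l ∷ ls) t → ¬ RemovedEntry C (single l) t →
               t ∈ transitions × Kept ls t
      sound′ (t∈C , inj₁ fwd)         _ = t∈C , inj₁ fwd
      sound′ (t∈C , inj₂ (there s∈)) _ = t∈C , inj₂ s∈
      sound′ {t} (t∈C , inj₂ (here s≡v)) ¬rm with target t Fin.≤? source t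
      ... | yes back = contradiction (here (entry⁺ l t∈C s≡v back)) ¬rm
      ... | no ¬back = t∈C , inj₁ (ℕ.≰⇒> ¬back)

  isRun : ∀ {D ls} → Stage D ls → Sorted ls → IsRun C D (map single ls)
  isRun {ls = []}    _     _               = tt
  isRun {ls = _ ∷ _} stage (l<ls ∷ sorted) =
    Eliminate.isMultiStep stage l<ls , isRun (Eliminate.next stage l<ls) sorted

  -- The body of the first loop lies below its start vertex, whereas all later loops start above it.
  isLayered : ∀ {D ls} → Stage D ls → Sorted ls → IsLayered C D (map single ls)
  isLayered {ls = []}     _     _               = tt
  isLayered {ls = l ∷ ls} stage (l<ls ∷ sorted) =
    (λ { _ m′ l′ (here refl) m′∈ l′∈ → outer m′∈ l′∈ }) ,
    isLayered (Eliminate.next stage l<ls) sorted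
    where
    outer : ∀ {m′ l′} → m′ ∈ map single ls → l′ ∈ toList m′ → ¬ InBody C _ (loop l) (vertex l′)
    outer m′∈ l′∈ inBody with ∈-map⁻ single m′∈
    outer m′∈ (here refl) inBody | _ , l″∈ , refl =
      ℕ.<-asym (Eliminate.body<v stage l<ls inBody) (All.lookup l<ls l″∈)

  -- Once no loop is left, all transitions increase the vertex number, so an infinite path would
  -- ascend forever in a finite order.
  isSuccessful : ∀ {D ls} → Stage D ls → Sorted ls → IsSuccessful C D (map single ls)
  isSuccessful {ls = []} stage _ (p , path) = descend 0 (>-wellFounded (p 0))
    where
    descend : ∀ i → ¬ Acc Fin._>_ (p i)
    descend i (acc rs) with sound stage (proj₂ (path i))
    ... | _ , inj₁ fwd = descend (suc i) (rs fwd)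
  isSuccessful {ls = _ ∷ _} stage (l<ls ∷ sorted) =
    isSuccessful (Eliminate.next stage l<ls) sorted

  -- A multi-step put in front raises the positive labels by one, while 0 continues to mark body
  -- transitions.
  shiftUp : ℕ → ℕ
  shiftUp zero    = zero
  shiftUp (suc k) = suc (suc k)

  labelling : List MaximalLoop → Tr → ℕ
  labelling []       t = 0
  labelling (l ∷ ls) t with backwardFrom? (at l) t
  ... | yes _ = 1
  ... | no _  = shiftUp (labelling ls t)

  labelling-backward : ∀ ls t → labelling ls t ≢ 0 → Backward t
  labelling-backward []       t ≢0 = contradiction refl ≢0
  labelling-backward (l ∷ ls) t ≢0 with backwardFrom? (at l) t
  ... | yes (_ , back) = back
  ... | no _           = labelling-backward ls t (≢0 ∘ cong shiftUp)

  RemovedAt : List MaximalLoop → ℕ → Tr → Set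
  RemovedAt ls k t = Σ[ i ∈ Fin (length (map single ls)) ]
    toℕ i ≡ k × RemovedEntry C (lookup (map single ls) i) t

  removedAt-source : ∀ {ls k t} → RemovedAt ls k t → source t ∈ map at ls
  removedAt-source {l ∷ _} (zero , _ , here t∈)  = here (proj₁ (proj₂ (entry⁻ l t∈)))
  removedAt-source {_ ∷ _} (suc i , refl , rm) = there (removedAt-source (i , refl , rm))

  labelling⁻ : ∀ ls {t} → t ∈ transitions → ∀ k → labelling ls t ≡ suc k → RemovedAt ls k t
  labelling⁻ (l ∷ ls) {t} t∈C k lab≡ with backwardFrom? (at l) t
  labelling⁻ (l ∷ ls) t∈C k refl | yes (s≡ , back) = zero , refl , here (entry⁺ l t∈C s≡ back)
  ... | no _ with labelling ls t in eq
  labelling⁻ (l ∷ ls) t∈C (suc k) refl | no _ | suc .k =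
    let i , i≡k , rm = labelling⁻ ls t∈C k eq in suc i , cong suc i≡k , rm

  -- `labelling` decides by the first loop that fits. Since sorted loops start at different
  -- vertices, no later loop can claim the same transition.
  labelling⁺ : ∀ {ls t} → Sorted ls → ∀ k → RemovedAt ls k t → labelling ls t ≡ suc k
  labelling⁺ {l ∷ ls} {t} (l<ls ∷ sorted) k rm with backwardFrom? (at l) t
  labelling⁺ {l ∷ ls} _ k (zero , refl , _) | yes _ = refl
  labelling⁺ {l ∷ ls} (l<ls ∷ _) k (suc i , refl , rm) | yes (refl , _) =
    contradiction (later {l} l<ls (removedAt-source (i , refl , rm))) (ℕ.<-irrefl refl)
  labelling⁺ {l ∷ ls} _ k (zero , refl , here t∈) | no ¬back =
    contradiction (proj₂ (entry⁻ l t∈)) ¬back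
  labelling⁺ {l ∷ ls} (_ ∷ sorted) k (suc i , refl , rm) | no _ =
    cong shiftUp (labelling⁺ sorted (toℕ i) (i , refl , rm))

  sorted : Sorted loops
  sorted = loopsAt-sorted (tabulate⁺-< id)

  isGuardedLLEE : IsGuardedLLEE C
  isGuardedLLEE =
    labelling loops ,
    ( map single loops
    , isRun stage-whole sorted
    , isLayered stage-whole sorted
    , isSuccessful stage-whole sorted
    , λ t t∈ k → mk⇔ (labelling⁻ loops t∈ k) (labelling⁺ sorted k)
    ) ,
    -- A 1-transition is forward, whereas only backward transitions have a nonzero label.
    λ { (transition v nothing w) t∈ ≢0 refl →
        ℕ.<⇒≱ (1-forward t∈) (labelling-backward loops (transition v nothing w) ≢0) }

  weaklyGuarded : WeaklyGuarded C
  weaklyGuarded v cyc = ℕ.<-irrefl refl (increases 1-forward cyc)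
    where
    increases : ∀ {R : Vertex → Vertex → Set} → (∀ {x y} → R x y → x Fin.< y) →
                ∀ {x y} → TransClosure R x y → x Fin.< y
    increases R⇒< Plus.[ x<y ]  = R⇒< x<y
    increases R⇒< (x<y Plus.∷ p) = ℕ.<-trans (R⇒< x<y) (increases R⇒< p)

-- Charts of star expressions

-- Codes of finite sets built by binary sums, to be ordered with the left part before the right.
-- Charts are thus composed without index arithmetic, which is confined to the translation into
-- `Fin`.
data Code : Set where
  ∅ pt : Code
  _⊞_  : Code → Code → Code

data Vertex : Code → Set where
  ●   : Vertex pt
  inl : ∀ {c d} → Vertex c → Vertex (c ⊞ d)
  inr : ∀ {c d} → Vertex d → Vertex (c ⊞ d)

infix 4 _≺_ _≼_

data _≺_ : ∀ {c} → Vertex c → Vertex c → Set where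
  inl : ∀ {c d} {v w : Vertex c} → v ≺ w → inl {d = d} v ≺ inl w
  inr : ∀ {c d} {v w : Vertex d} → v ≺ w → inr {c = c} v ≺ inr w
  sep : ∀ {c d} {v : Vertex c} {w : Vertex d} → inl v ≺ inr w

data _≼_ : ∀ {c} → Vertex c → Vertex c → Set where
  ●   : ● ≼ ●
  inl : ∀ {c d} {v w : Vertex c} → v ≼ w → inl {d = d} v ≼ inl w
  inr : ∀ {c d} {v w : Vertex d} → v ≼ w → inr {c = c} v ≼ inr w
  sep : ∀ {c d} {v : Vertex c} {w : Vertex d} → inl v ≼ inr w

Edges : Set → Code → Set
Edges A c = List (Label A × Vertex c)

-- `accepting` and `heads` describe an absent start vertex. Heads have proper labels, so that the
-- loop entries formed from them by `starˢ` are guarded.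
record Shape (A : Set) (c : Code) : Set where
  constructor shape
  field
    accepting : Bool
    heads     : List (A × Vertex c)
    out       : Vertex c → Edges A c
    final     : Vertex c → Bool

open Shape

shift : ∀ {B : Set} {c d} → (Vertex c → Vertex d) → List (B × Vertex c) → List (B × Vertex d)
shift f = map (map₂ f)

proper : ∀ {A c} → List (A × Vertex c) → Edges A c
proper = map (map₁ just)

module _ {A : Set} {c : Code} (F : Shape A c) where

  Forward : Vertex c → Vertex c → Set
  Forward v w = ∃[ a ] (a , w) ∈ out F v × v ≺ w

  Reached : Set
  Reached = ∀ v → ∃[ h ] h ∈ heads F × Star Forward (proj₂ h) v

  -- The conditions of `IsLayout` other than reachability, at a single vertex, so that a vertex of a
  -- composition can inherit them from its component.
  record LaidOut (v : Vertex c) : Set where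
    field
      1-forward : ∀ {w} → (nothing , w) ∈ out F v → v ≺ w
      block     : ∀ {a w u} → (a , w) ∈ out F v → w ≼ v → w ≼ u → u ≺ v →
                  final F u ≡ false × (∀ {b x} → (b , x) ∈ out F u → x ≼ v)
      cycle     : ∀ {a w} → (a , w) ∈ out F v → w ≼ v →
                  ∃[ h ] h ∈ out F v × proj₂ h ≼ v × Star Forward (proj₂ h) v

open LaidOut

record Nested {A : Set} {c : Code} (F : Shape A c) : Set where
  field
    reached : Reached F
    laidOut : ∀ v → LaidOut F v

open Nested

∈-shift⁺ : ∀ {B : Set} {c d} {f : Vertex c → Vertex d} {a : B} {w xs} →
           (a , w) ∈ xs → (a , f w) ∈ shift f xs
∈-shift⁺ = ∈-map⁺ _

∈-shift⁻ : ∀ {B : Set} {c d} {f : Vertex c → Vertex d} {a : B} {x} xs →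
           (a , x) ∈ shift f xs → ∃[ w ] (a , w) ∈ xs × x ≡ f w
∈-shift⁻ xs a∈ with (_ , w) , w∈ , refl ← ∈-map⁻ _ a∈ = w , w∈ , refl

module Left {A : Set} {c d : Code} (F : Shape A c) (H : Shape A (c ⊞ d))
            (link : Vertex c → Edges A d)
            (out-H : ∀ v → out H (inl v) ≡ shift inl (out F v) ++ shift inr (link v)) where

  out-inl⁺ : ∀ {v a w} → (a , w) ∈ out F v → (a , inl w) ∈ out H (inl v)
  out-inl⁺ {v} w∈ rewrite out-H v = ∈-++⁺ˡ (∈-shift⁺ w∈)

  out-link⁺ : ∀ {v a w} → (a , w) ∈ link v → (a , inr w) ∈ out H (inl v)
  out-link⁺ {v} w∈ rewrite out-H v = ∈-++⁺ʳ (shift inl (out F v)) (∈-shift⁺ w∈)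

  out-inl⁻ : ∀ {v a x} → (a , x) ∈ out H (inl v) →
             (∃[ w ] (a , w) ∈ out F v × x ≡ inl w) ⊎ (∃[ w ] (a , w) ∈ link v × x ≡ inr w)
  out-inl⁻ {v} x∈ rewrite out-H v with ∈-++⁻ (shift inl (out F v)) x∈
  ... | inj₁ x∈ˡ = inj₁ (∈-shift⁻ (out F v) x∈ˡ)
  ... | inj₂ x∈ʳ = inj₂ (∈-shift⁻ (link v) x∈ʳ)

  forward-inl : ∀ {v w} → Star (Forward F) v w → Star (Forward H) (inl v) (inl w)
  forward-inl = gmap inl λ { (a , w∈ , v≺w) → a , out-inl⁺ w∈ , inl v≺w }

  -- Links lead to the right and hence forward, so they add no loop entry. Vertices inside a loop
  -- are not final by `block`, so they receive no link and existing loops stay intact.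
  laidOut-inl : (∀ v → final F v ≡ false → link v ≡ [] × final H (inl v) ≡ false) →
                ∀ {v} → LaidOut F v → LaidOut H (inl v)
  laidOut-inl nonfinal {v} L = record { 1-forward = 1-fwd ; block = blk ; cycle = cyc }
    where
    1-fwd : ∀ {w} → (nothing , w) ∈ out H (inl v) → inl v ≺ w
    1-fwd w∈ with out-inl⁻ w∈
    ... | inj₁ (_ , w∈F , refl) = inl (1-forward L w∈F)
    ... | inj₂ (_ , _   , refl) = sep

    blk : ∀ {a w u} → (a , w) ∈ out H (inl v) → w ≼ inl v → w ≼ u → u ≺ inl v →
          final H u ≡ false × (∀ {b x} → (b , x) ∈ out H u → x ≼ inl v)
    blk w∈ (inl w≼v) (inl w≼u) (inl {v = u} u≺v) with out-inl⁻ w∈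
    ... | inj₁ (_ , w∈F , refl) with block L w∈F w≼v w≼u u≺v
    ... | nonfinal-u , out-u = proj₂ (nonfinal u nonfinal-u) , out-u′
      where
      out-u′ : ∀ {b x} → (b , x) ∈ out H (inl u) → x ≼ inl v
      out-u′ x∈ with out-inl⁻ x∈
      ... | inj₁ (_ , x∈F , refl) = inl (out-u x∈F)
      ... | inj₂ (_ , x∈link , refl) with () ← subst (_ ∈_) (proj₁ (nonfinal u nonfinal-u)) x∈link

    cyc : ∀ {a w} → (a , w) ∈ out H (inl v) → w ≼ inl v →
          ∃[ h ] h ∈ out H (inl v) × proj₂ h ≼ inl v × Star (Forward H) (proj₂ h) (inl v)
    cyc w∈ (inl w≼v) with out-inl⁻ w∈
    ... | inj₁ (_ , w∈F , refl) with cycle L w∈F w≼v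
    ... | (b , x) , x∈ , x≼v , path = (b , inl x) , out-inl⁺ x∈ , inl x≼v , forward-inl path

module Right {A : Set} {c d : Code} (G : Shape A d) (H : Shape A (c ⊞ d))
             (out-H : ∀ v → out H (inr v) ≡ shift inr (out G v)) where

  out-inr⁺ : ∀ {v a w} → (a , w) ∈ out G v → (a , inr w) ∈ out H (inr v)
  out-inr⁺ {v} w∈ rewrite out-H v = ∈-shift⁺ w∈

  out-inr⁻ : ∀ {v a x} → (a , x) ∈ out H (inr v) → ∃[ w ] (a , w) ∈ out G v × x ≡ inr w
  out-inr⁻ {v} x∈ rewrite out-H v = ∈-shift⁻ (out G v) x∈

  forward-inr : ∀ {v w} → Star (Forward G) v w → Star (Forward H) (inr v) (inr w)
  forward-inr = gmap inr λ { (a , w∈ , v≺w) → a , out-inr⁺ w∈ , inr v≺w }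

  laidOut-inr : (∀ v → final H (inr v) ≡ final G v) → ∀ {v} → LaidOut G v → LaidOut H (inr v)
  laidOut-inr final-H {v} L = record { 1-forward = 1-fwd ; block = blk ; cycle = cyc }
    where
    1-fwd : ∀ {w} → (nothing , w) ∈ out H (inr v) → inr v ≺ w
    1-fwd w∈ with _ , w∈G , refl ← out-inr⁻ w∈ = inr (1-forward L w∈G)

    blk : ∀ {a w u} → (a , w) ∈ out H (inr v) → w ≼ inr v → w ≼ u → u ≺ inr v →
          final H u ≡ false × (∀ {b x} → (b , x) ∈ out H u → x ≼ inr v)
    blk w∈ w≼v w≼u u≺v with out-inr⁻ w∈
    blk w∈ (inr w≼v) (inr w≼u) (inr {v = u} u≺v) | _ , w∈G , refl
      with block L w∈G w≼v w≼u u≺v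
    ... | nonfinal-u , out-u =
      trans (final-H u) nonfinal-u ,
      λ x∈ → let _ , x∈G , x≡ = out-inr⁻ x∈ in subst (_≼ inr v) (sym x≡) (inr (out-u x∈G))

    cyc : ∀ {a w} → (a , w) ∈ out H (inr v) → w ≼ inr v →
          ∃[ h ] h ∈ out H (inr v) × proj₂ h ≼ inr v × Star (Forward H) (proj₂ h) (inr v)
    cyc w∈ w≼v with out-inr⁻ w∈
    cyc w∈ (inr w≼v) | _ , w∈G , refl with cycle L w∈G w≼v
    ... | (b , x) , x∈ , x≼v , path = (b , inr x) , out-inr⁺ x∈ , inr x≼v , forward-inr path

search : ∀ {c} (p : Vertex c → Bool) → (∃[ v ] p v ≡ true) ⊎ (∀ v → p v ≡ false)
search {∅} p = inj₂ λ ()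
search {pt} p with p ● in eq
... | true  = inj₁ (● , eq)
... | false = inj₂ λ { ● → eq }
search {c ⊞ d} p with search (p ∘ inl) | search (p ∘ inr)
... | inj₁ (v , eq) | _             = inj₁ (inl v , eq)
... | inj₂ _        | inj₁ (v , eq) = inj₁ (inr v , eq)
... | inj₂ none     | inj₂ none′    = inj₂ λ { (inl v) → none v ; (inr v) → none′ v }

module _ {A : Set} where

  edge : {B : Set} → (B → StExp A) → Label A × B → StExp A
  edge s (a , w) = ⟦ a ⟧ · s w

  head : {B : Set} → (B → StExp A) → A × B → StExp A
  head s (a , w) = act a · s w

  infix 5 _when_

  _when_ : StExp A → Bool → StExp A
  g when b = if b then g else 𝟘

  Solves : System A → ∀ {c} → Shape A c → StExp A → (Vertex c → StExp A) → Set
  Solves S F g s = ∀ v → S ⊢ s v ≐ (g when final F v) + ∑⟨ edge s ⟩ (out F v)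

  -- F describes X when its final vertices continue as g; F has no start vertex, its
  -- heads are the transitions of X itself.
  record Realizes (S : System A) {c} (F : Shape A c) (g X : StExp A) : Set where
    field
      solution : Vertex c → StExp A
      solves   : Solves S F g solution
      value    : S ⊢ X ≐ (g when accepting F) + ∑⟨ head solution ⟩ (heads F)

  zeroˢ : Shape A ∅
  zeroˢ = shape false [] (λ ()) (λ ())

  oneˢ : Shape A ∅
  oneˢ = shape true [] (λ ()) (λ ())

  actˢ : A → Shape A pt
  actˢ a = shape false [ a , ● ] (λ _ → []) (λ _ → true)

  nested-zero : Nested zeroˢ
  nested-zero = record { reached = λ () ; laidOut = λ () }

  nested-one : Nested oneˢ
  nested-one = record { reached = λ () ; laidOut = λ () }

  nested-act : ∀ a → Nested (actˢ a)
  nested-act a = record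
    { reached = λ { ● → (a , ●) , here refl , ε }
    ; laidOut = λ _ → record { 1-forward = λ () ; block = λ () ; cycle = λ () }
    }

  module _ {c d} (F : Shape A c) (G : Shape A d) where

    sumˢ : Shape A (c ⊞ d)
    sumˢ .accepting     = accepting F ∨ accepting G
    sumˢ .heads         = shift inl (heads F) ++ shift inr (heads G)
    sumˢ .out (inl v)   = shift inl (out F v) ++ []
    sumˢ .out (inr v)   = shift inr (out G v)
    sumˢ .final (inl v) = final F v
    sumˢ .final (inr v) = final G v

    nested-sum : Nested F → Nested G → Nested sumˢ
    nested-sum NF NG = record { reached = rch ; laidOut = laid }
      where
      open Left F sumˢ (λ _ → []) (λ _ → refl)
      open Right G sumˢ (λ _ → refl)

      rch : Reached sumˢ
      rch (inl v) with reached NF v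
      ... | (a , w) , w∈ , path =
        (a , inl w) , ∈-++⁺ˡ (∈-shift⁺ w∈) , forward-inl path
      rch (inr v) with reached NG v
      ... | (a , w) , w∈ , path =
        (a , inr w) , ∈-++⁺ʳ (shift inl (heads F)) (∈-shift⁺ w∈) , forward-inr path

      laid : ∀ v → LaidOut sumˢ v
      laid (inl v) = laidOut-inl (λ _ eq → refl , eq) (laidOut NF v)
      laid (inr v) = laidOut-inr (λ _ → refl) (laidOut NG v)

    continue : Bool → Edges A d
    continue b = if b then proper (heads G) else []

    prodˢ : Shape A (c ⊞ d)
    prodˢ .accepting     = accepting F ∧ accepting G
    prodˢ .heads         = shift inl (heads F) ++ (if accepting F then shift inr (heads G) else [])
    prodˢ .out (inl v)   = shift inl (out F v) ++ shift inr (continue (final F v))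
    prodˢ .out (inr v)   = shift inr (out G v)
    prodˢ .final (inl v) = final F v ∧ accepting G
    prodˢ .final (inr v) = final G v

    nested-prod : accepting F ≡ true ⊎ (∃[ v ] final F v ≡ true) →
                  Nested F → Nested G → Nested prodˢ
    nested-prod exit NF NG = record { reached = rch exit ; laidOut = laid }
      where
      link : Vertex c → Edges A d
      link v = continue (final F v)

      open Left F prodˢ link (λ _ → refl)
      open Right G prodˢ (λ _ → refl)

      rchˡ : ∀ v → ∃[ h ] h ∈ heads prodˢ × Star (Forward prodˢ) (proj₂ h) (inl v)
      rchˡ v with reached NF v
      ... | (a , w) , w∈ , path =
        (a , inl w) , ∈-++⁺ˡ (∈-shift⁺ w∈) , forward-inl path

      rch : accepting F ≡ true ⊎ (∃[ v ] final F v ≡ true) → Reached prodˢ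
      rch _ (inl v) = rchˡ v
      rch (inj₁ F-acc) (inr v) with reached NG v
      ... | (a , w) , w∈ , path rewrite F-acc =
        (a , inr w) , ∈-++⁺ʳ (shift inl (heads F)) (∈-shift⁺ w∈) ,
        forward-inr path
      rch (inj₂ (u , final-u)) (inr v) with reached NG v | rchˡ u
      ... | (a , w) , w∈ , path | h , h∈ , path-u =
        h , h∈ , path-u ◅◅ (just a , out-link⁺ w∈link , sep)
                        ◅ forward-inr path
        where
        w∈link : (just a , w) ∈ link u
        w∈link rewrite final-u = ∈-map⁺ (map₁ just) w∈

      nonfinal : ∀ v → final F v ≡ false → link v ≡ [] × final F v ∧ accepting G ≡ false
      nonfinal v eq rewrite eq = refl , refl

      laid : ∀ v → LaidOut prodˢ v
      laid (inl v) = laidOut-inl nonfinal (laidOut NF v)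
      laid (inr v) = laidOut-inr (λ _ → refl) (laidOut NG v)

  module _ {c} (F : Shape A c) where

    loopback : Bool → Edges A pt
    loopback b = if b then [ nothing , ● ] else []

    -- The new last vertex stands for the iteration itself. The 1-transitions into it are forward;
    -- the heads that lead from it back into `F` are its loop entries and are proper. As the only
    -- final vertex it leaves no termination in the body.
    starˢ : Shape A (c ⊞ pt)
    starˢ .accepting     = true
    starˢ .heads         = shift inl (heads F)
    starˢ .out (inl v)   = shift inl (out F v) ++ shift inr (loopback (final F v))
    starˢ .out (inr ●)   = shift inl (proper (heads F))
    starˢ .final (inl v) = false
    starˢ .final (inr ●) = true

    nested-star : (∃[ v ] final F v ≡ true) → Nested F → Nested starˢ
    nested-star (u , final-u) NF = record { reached = rch ; laidOut = laid }
      where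
      link : Vertex c → Edges A pt
      link v = loopback (final F v)

      open Left F starˢ link (λ _ → refl)

      loopback-u : Forward starˢ (inl u) (inr ●)
      loopback-u = nothing , out-link⁺ ●∈ , sep
        where
        ●∈ : (nothing , ●) ∈ link u
        ●∈ rewrite final-u = here refl

      rch : Reached starˢ
      rch (inl v) with reached NF v
      ... | (a , w) , w∈ , path = (a , inl w) , ∈-shift⁺ w∈ , forward-inl path
      rch (inr ●) with rch (inl u)
      ... | h , h∈ , path = h , h∈ , path ◅◅ loopback-u ◅ ε

      ≼-last : ∀ x → x ≼ inr {c = c} ●
      ≼-last (inl _) = sep
      ≼-last (inr ●) = inr ●

      nonfinal : ∀ v → final F v ≡ false → link v ≡ [] × false ≡ false
      nonfinal v eq rewrite eq = refl , refl

      laid : ∀ v → LaidOut starˢ v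
      laid (inl v) = laidOut-inl nonfinal (laidOut NF v)
      laid (inr ●) = record { 1-forward = 1-fwd ; block = blk ; cycle = cyc }
        where
        1-fwd : ∀ {w} → (nothing , w) ∈ shift inl (proper (heads F)) → inr ● ≺ w
        1-fwd w∈ with _ , w∈heads , refl ← ∈-shift⁻ (proper (heads F)) w∈
          with ∈-map⁻ (map₁ just) w∈heads
        ... | _ , _ , ()

        blk : ∀ {a w v} → (a , w) ∈ shift inl (proper (heads F)) → w ≼ inr ● → w ≼ v →
              v ≺ inr ● → final starˢ v ≡ false × (∀ {b x} → (b , x) ∈ out starˢ v → x ≼ inr ●)
        blk _ _ _ sep = refl , λ {_} {x} _ → ≼-last x

        cyc : ∀ {a w} → (a , w) ∈ shift inl (proper (heads F)) → w ≼ inr ● →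
              ∃[ h ] h ∈ shift inl (proper (heads F)) × proj₂ h ≼ inr ● ×
                     Star (Forward starˢ) (proj₂ h) (inr ●)
        cyc _ _ with reached NF u
        ... | (a , w) , w∈ , path =
          (just a , inl w) , ∈-shift⁺ (∈-map⁺ (map₁ just) w∈) , sep ,
          forward-inl path ◅◅ loopback-u ◅ ε

open Realizes

copair : ∀ {c d} {B : Set} → (Vertex c → B) → (Vertex d → B) → Vertex (c ⊞ d) → B
copair s t (inl v) = s v
copair s t (inr w) = t w

-- Solutions of composed shapes.

module Realization {A : Set} (S : System A) (Mil⁻⊑S : Mil⁻ A ⊑ S) where

  open Theory S Mil⁻⊑S

  ∑-proper : ∀ {c} {s : Vertex c → StExp A} xs → ∑⟨ edge s ⟩ (proper xs) ≈ ∑⟨ head s ⟩ xs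
  ∑-proper xs = ≈-reflexive (∑-map _ xs)

  module _ {c d} {s : Vertex c → StExp A} {t : Vertex d → StExp A} where

    ∑-edges : ∀ xs ys → ∑⟨ edge (copair s t) ⟩ (shift inl xs ++ shift inr ys) ≈
                        ∑⟨ edge s ⟩ xs + ∑⟨ edge t ⟩ ys
    ∑-edges xs ys = ≈-trans (∑-++ (shift inl xs))
      (+-cong (≈-reflexive (∑-map _ xs)) (≈-reflexive (∑-map _ ys)))

    ∑-heads : ∀ xs ys → ∑⟨ head (copair s t) ⟩ (shift inl xs ++ shift inr ys) ≈
                        ∑⟨ head s ⟩ xs + ∑⟨ head t ⟩ ys
    ∑-heads xs ys = ≈-trans (∑-++ (shift inl xs))
      (+-cong (≈-reflexive (∑-map _ xs)) (≈-reflexive (∑-map _ ys)))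

  when-· : ∀ b g → (𝟙 when b) · g ≈ (g when b)
  when-· true  g = ≈-axiom (·-identityˡ g)
  when-· false g = ≈-axiom (·-zeroˡ g)

  ∑-edge-· : ∀ {c} (s : Vertex c → StExp A) g xs →
             ∑⟨ edge s ⟩ xs · g ≈ ∑⟨ edge (λ v → s v · g) ⟩ xs
  ∑-edge-· s g xs = ≈-trans (∑-·ʳ xs g) (∑-cong xs λ _ → ≈-axiom (·-assoc _ _ g))

  ∑-head-· : ∀ {c} (s : Vertex c → StExp A) g xs →
             ∑⟨ head s ⟩ xs · g ≈ ∑⟨ head (λ v → s v · g) ⟩ xs
  ∑-head-· s g xs = ≈-trans (∑-·ʳ xs g) (∑-cong xs λ _ → ≈-axiom (·-assoc _ _ g))

  -- Right multiplication by `g` turns the exit value 𝟙 into `g`; right distributivity and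
  -- associativity carry it through the sums.
  realizes-continue : ∀ {c} {F : Shape A c} {e} g → Realizes S F 𝟙 e → Realizes S F g (e · g)
  realizes-continue {F = F} {e} g R = record
    { solution = λ v → solution R v · g
    ; solves   = λ v → begin
        solution R v · g
          ≈⟨ ·-cong (solves R v) ≈-refl ⟩
        ((𝟙 when final F v) + ∑⟨ edge (solution R) ⟩ (out F v)) · g
          ≈⟨ ≈-axiom (·-distribʳ _ _ g) ⟩
        (𝟙 when final F v) · g + ∑⟨ edge (solution R) ⟩ (out F v) · g
          ≈⟨ +-cong (when-· (final F v) g) (∑-edge-· (solution R) g (out F v)) ⟩
        (g when final F v) + ∑⟨ edge (λ w → solution R w · g) ⟩ (out F v) ∎
    ; value    = begin
        e · g
          ≈⟨ ·-cong (value R) ≈-refl ⟩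
        ((𝟙 when accepting F) + ∑⟨ head (solution R) ⟩ (heads F)) · g
          ≈⟨ ≈-axiom (·-distribʳ _ _ g) ⟩
        (𝟙 when accepting F) · g + ∑⟨ head (solution R) ⟩ (heads F) · g
          ≈⟨ +-cong (when-· (accepting F) g) (∑-head-· (solution R) g (heads F)) ⟩
        (g when accepting F) + ∑⟨ head (λ w → solution R w · g) ⟩ (heads F) ∎
    }

  realizes-resp : ∀ {c} {F : Shape A c} {g X Y} → X ≈ Y → Realizes S F g X → Realizes S F g Y
  realizes-resp X≈Y R = record
    { solution = solution R ; solves = solves R ; value = ≈-trans (≈-sym X≈Y) (value R) }

  realizes-zero : ∀ {g} → Realizes S zeroˢ g 𝟘
  realizes-zero = record { solution = λ () ; solves = λ () ; value = ≈-sym (+-identityˡ 𝟘) }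

  realizes-one : ∀ {g} → Realizes S oneˢ g g
  realizes-one = record { solution = λ () ; solves = λ () ; value = ≈-sym (≈-axiom (+-identity _)) }

  realizes-act : ∀ a → Realizes S (actˢ a) 𝟙 (act a)
  realizes-act a = record
    { solution = λ _ → 𝟙
    ; solves   = λ _ → ≈-sym (≈-axiom (+-identity 𝟙))
    ; value    = ≈-sym (≈-trans (+-identityˡ _)
                   (≈-trans (≈-axiom (+-identity _)) (≈-axiom (·-identityʳ (act a)))))
    }

  when-∨ : ∀ a b {g} → (g when a) + (g when b) ≈ (g when (a ∨ b))
  when-∨ true  true  = ≈-axiom (+-idem _)
  when-∨ true  false = ≈-axiom (+-identity _)
  when-∨ false b     = +-identityˡ _

  realizes-sum : ∀ {c d} {F : Shape A c} {G : Shape A d} {g X Y} →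
                 Realizes S F g X → Realizes S G g Y → Realizes S (sumˢ F G) g (X + Y)
  realizes-sum {F = F} {G} {g} {X} {Y} R Q = record
    { solution = u ; solves = sol ; value = val }
    where
    u : Vertex _ → StExp A
    u = copair (solution R) (solution Q)

    sol : Solves S (sumˢ F G) g u
    sol (inl v) = ≈-trans (solves R v)
      (+-cong ≈-refl (≈-sym (≈-trans (∑-edges (out F v) []) (≈-axiom (+-identity _)))))
    sol (inr v) = ≈-trans (solves Q v)
      (+-cong ≈-refl (≈-sym (≈-reflexive (∑-map _ (out G v)))))

    val : X + Y ≈ (g when (accepting F ∨ accepting G)) + ∑⟨ head u ⟩ (heads (sumˢ F G))
    val = begin
      X + Y
        ≈⟨ +-cong (value R) (value Q) ⟩
      ((g when accepting F) + ∑⟨ head (solution R) ⟩ (heads F)) +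
      ((g when accepting G) + ∑⟨ head (solution Q) ⟩ (heads G))
        ≈⟨ +-interchange _ _ _ _ ⟩
      ((g when accepting F) + (g when accepting G)) +
      (∑⟨ head (solution R) ⟩ (heads F) + ∑⟨ head (solution Q) ⟩ (heads G))
        ≈⟨ +-cong (when-∨ (accepting F) (accepting G)) (≈-sym (∑-heads (heads F) (heads G))) ⟩
      (g when (accepting F ∨ accepting G)) + ∑⟨ head u ⟩ (heads (sumˢ F G)) ∎

  -- Moves the part `g` of a constant, which stems from the link edges, into the sum over all edges.
  +-shuffle : ∀ {e f g h i} → e ≈ f + g → h ≈ i + g → e + i ≈ f + h
  +-shuffle {e} {f} {g} {h} {i} p q = begin
    e + i        ≈⟨ +-cong p ≈-refl ⟩
    (f + g) + i  ≈⟨ ≈-axiom (+-assoc f g i) ⟩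
    f + (g + i)  ≈⟨ +-cong ≈-refl (≈-trans (≈-axiom (+-comm g i)) (≈-sym q)) ⟩
    f + h        ∎

  -- Wherever the solution for `F` exits with `Y`, the equation for `Y` given by `G` is substituted.
  realizes-prod : ∀ {c d} {F : Shape A c} {G : Shape A d} {g X Y} →
                  Realizes S F Y X → Realizes S G g Y → Realizes S (prodˢ F G) g X
  realizes-prod {F = F} {G} {g} {X} {Y} R Q = record
    { solution = u ; solves = sol ; value = val }
    where
    u : Vertex _ → StExp A
    u = copair (solution R) (solution Q)

    when-Y : ∀ b → (Y when b) ≈ (g when (b ∧ accepting G)) + ∑⟨ edge (solution Q) ⟩ (continue F G b)
    when-Y true  = ≈-trans (value Q) (+-cong ≈-refl (≈-sym (∑-proper (heads G))))
    when-Y false = ≈-sym (+-identityˡ 𝟘)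

    sol : Solves S (prodˢ F G) g u
    sol (inl v) = ≈-trans (solves R v)
      (+-shuffle (when-Y (final F v)) (∑-edges (out F v) (continue F G (final F v))))
    sol (inr v) = ≈-trans (solves Q v)
      (+-cong ≈-refl (≈-sym (≈-reflexive (∑-map _ (out G v)))))

    ∑-prod-heads : ∀ b →
                   ∑⟨ head u ⟩ (shift inl (heads F) ++ (if b then shift inr (heads G) else [])) ≈
                         ∑⟨ head (solution R) ⟩ (heads F) +
                         ∑⟨ edge (solution Q) ⟩ (continue F G b)
    ∑-prod-heads true  = ≈-trans (∑-heads (heads F) (heads G))
      (+-cong ≈-refl (≈-sym (∑-proper (heads G))))
    ∑-prod-heads false = ∑-heads (heads F) []

    val : X ≈ (g when (accepting F ∧ accepting G)) + ∑⟨ head u ⟩ (heads (prodˢ F G))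
    val = ≈-trans (value R) (+-shuffle (when-Y (accepting F)) (∑-prod-heads (accepting F)))

  -- `X` may be any solution of the fixed-point equation and need not be an iteration; the treatment
  -- of RSP* depends on this generality.
  realizes-star : ∀ {c} {F : Shape A c} {X Y s} → Solves S F X s →
                  X ≈ ∑⟨ head s ⟩ (heads F) + Y → Realizes S (starˢ F) Y X
  realizes-star {F = F} {X} {Y} {s} sol-s X≈ = record
    { solution = u
    ; solves   = sol
    ; value    = ≈-trans X≈Y+ (+-cong ≈-refl (≈-sym (≈-reflexive (∑-map _ (heads F)))))
    }
    where
    u : Vertex _ → StExp A
    u = copair s (λ _ → X)

    X≈Y+ : X ≈ Y + ∑⟨ head s ⟩ (heads F)
    X≈Y+ = ≈-trans X≈ (≈-axiom (+-comm _ _))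

    when-X : ∀ b → (X when b) ≈ 𝟘 + ∑⟨ edge (λ _ → X) ⟩ (loopback F b)
    when-X true  = ≈-sym (≈-trans (+-identityˡ _)
      (≈-trans (≈-axiom (+-identity _)) (≈-axiom (·-identityˡ X))))
    when-X false = ≈-sym (+-identityˡ 𝟘)

    sol : Solves S (starˢ F) Y u
    sol (inl v) = ≈-trans (sol-s v)
      (+-shuffle (when-X (final F v)) (∑-edges (out F v) (loopback F (final F v))))
    sol (inr ●) = ≈-trans X≈Y+ (+-cong ≈-refl (≈-sym (≈-trans
      (≈-reflexive (∑-map _ (proper (heads F)))) (∑-proper (heads F)))))

  solves-nonfinal : ∀ {c} {F : Shape A c} {g s} h → (∀ v → final F v ≡ false) →
                    Solves S F g s → Solves S F h s
  solves-nonfinal {F = F} h nonfinal sol v with final F v | nonfinal v | sol v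
  ... | .false | refl | eq = eq

  -- A summand 𝟙 of `e` is dropped under the star by `*-𝟙+`, so that only the part `h` given by the
  -- heads remains in the loop.
  star-unfold : ∀ b {e h} → e ≈ (𝟙 when b) + h → e * ≈ h · e * + 𝟙
  star-unfold b {e} {h} e≈ = begin
    e *          ≈⟨ e*≈h* b e≈ ⟩
    h *          ≈⟨ ≈-axiom (*-unfold h) ⟩
    𝟙 + h · h *  ≈⟨ ≈-axiom (+-comm _ _) ⟩
    h · h * + 𝟙  ≈⟨ +-cong (·-cong ≈-refl (e*≈h* b e≈)) ≈-refl ⟨
    h · e * + 𝟙  ∎
    where
    e*≈h* : ∀ b → e ≈ (𝟙 when b) + h → e * ≈ h *
    e*≈h* true  eq = ≈-trans (*-cong eq) (≈-sym (≈-axiom (*-𝟙+ h)))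
    e*≈h* false eq = *-cong (≈-trans eq (+-identityˡ h))

-- Fragments that implement star expressions and fixed points.

module _ {A : Set} where

  record Nesting : Set where
    constructor nesting
    field
      {code} : Code
      frame  : Shape A code
      nested : Nested frame

  open Nesting

  _implements_⟫_ : Nesting → StExp A → StExp A → Set₁
  N implements X ⟫ g = ∀ {S} → Mil⁻ A ⊑ S → Realizes S (frame N) g X

  product : (N M : Nesting) → Σ[ P ∈ Nesting ]
            (accepting (frame P) ≡ true → accepting (frame N) ≡ true × accepting (frame M) ≡ true) ×
            (∀ {S g X Y} → Mil⁻ A ⊑ S → Realizes S (frame N) Y X → Realizes S (frame M) g Y →
             Realizes S (frame P) g X)
  product (nesting F NF) (nesting G NG) with accepting F in F-acc | search (final F)
  ... | true | _ =
    nesting (prodˢ F G) (nested-prod F G (inj₁ F-acc) NF NG) ,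
    (λ eq → refl , trans (cong (_∧ accepting G) (sym F-acc)) eq) ,
    λ Mil⁻⊑S → Realization.realizes-prod _ Mil⁻⊑S
  ... | false | inj₁ exit =
    nesting (prodˢ F G) (nested-prod F G (inj₂ exit) NF NG) ,
    (λ eq → contradiction (trans (cong (_∧ accepting G) (sym F-acc)) eq) λ ()) ,
    λ Mil⁻⊑S → Realization.realizes-prod _ Mil⁻⊑S
  -- `F` has no exit, so the vertices of `G` would be unreachable. `F` itself serves instead, since
  -- without exits the exit value is arbitrary.
  ... | false | inj₂ nonfinal =
    nesting F NF ,
    (λ eq → contradiction (trans (sym F-acc) eq) λ ()) ,
    λ {_} {g} {X} {Y} Mil⁻⊑S R _ → record
      { solution = solution R
      ; solves   = Realization.solves-nonfinal _ Mil⁻⊑S {F = F} g nonfinal (solves R)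
      ; value    = subst (λ b → _ ⊢ X ≐ (g when b) + _) (sym F-acc)
                     (subst (λ b → _ ⊢ X ≐ (Y when b) + _) F-acc (value R))
      }

  iteration : (N : Nesting) → Σ[ P ∈ Nesting ]
              (∀ {S X Y s} → Mil⁻ A ⊑ S → Solves S (frame N) X s →
               S ⊢ X ≐ ∑⟨ head s ⟩ (heads (frame N)) + Y → Realizes S (frame P) Y X)
  iteration (nesting F NF) with search (final F)
  ... | inj₁ exit =
    nesting (starˢ F) (nested-star F exit NF) , λ Mil⁻⊑S → Realization.realizes-star _ Mil⁻⊑S
  -- Without an exit from `F` no cycle back would exist. A single pass through `F` suffices, and `Y`
  -- enters through `accepting`.
  ... | inj₂ nonfinal =
    nesting (record F { accepting = true })
            (record { reached = reached NF ; laidOut = λ v → record { LaidOut (laidOut NF v) } }) ,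
    λ {_} {_} {Y} {s} Mil⁻⊑S sol X≈ → record
      { solution = s
      ; solves   = Realization.solves-nonfinal _ Mil⁻⊑S {F = F} Y nonfinal sol
      ; value    = let open Theory _ Mil⁻⊑S in ≈-trans X≈ (≈-axiom (+-comm _ _))
      }

  -- `accepting⇒↓` connects the side condition of RSP*, stated for expressions, with the acceptance
  -- of the fragment.
  record Implementation (e : StExp A) : Set₁ where
    field
      net         : Nesting
      realizes    : net implements e ⟫ 𝟙
      accepting⇒↓ : accepting (frame net) ≡ true → e ↓

  open Implementation

  implementation : (e : StExp A) → Implementation e
  implementation 𝟘 = record
    { net         = nesting zeroˢ nested-zero
    ; realizes    = λ Mil⁻⊑S → Realization.realizes-zero _ Mil⁻⊑S
    ; accepting⇒↓ = λ ()
    }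
  implementation 𝟙 = record
    { net         = nesting oneˢ nested-one
    ; realizes    = λ Mil⁻⊑S → Realization.realizes-one _ Mil⁻⊑S
    ; accepting⇒↓ = λ _ → 𝟙↓
    }
  implementation (act a) = record
    { net         = nesting (actˢ a) (nested-act a)
    ; realizes    = λ Mil⁻⊑S → Realization.realizes-act _ Mil⁻⊑S a
    ; accepting⇒↓ = λ ()
    }
  implementation (e + f) = record
    { net         = nesting (sumˢ F G) (nested-sum F G (nested (net I)) (nested (net J)))
    ; realizes    = λ Mil⁻⊑S →
        Realization.realizes-sum _ Mil⁻⊑S (realizes I Mil⁻⊑S) (realizes J Mil⁻⊑S)
    ; accepting⇒↓ = ∨⇒↓ (accepting F) (accepting G) (accepting⇒↓ I) (accepting⇒↓ J)
    }
    where
    I = implementation e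
    J = implementation f
    F = frame (net I)
    G = frame (net J)

    ∨⇒↓ : ∀ a b → (a ≡ true → e ↓) → (b ≡ true → f ↓) → a ∨ b ≡ true → e + f ↓
    ∨⇒↓ true  _    e↓ _  _ = +↓ˡ (e↓ refl)
    ∨⇒↓ false true _  f↓ _ = +↓ʳ (f↓ refl)
  implementation (e · f) with implementation e | implementation f
  ... | I | J with product (net I) (net J)
  ... | P , both , prod = record
    { net         = P
    ; realizes    = λ Mil⁻⊑S → prod Mil⁻⊑S
        (Realization.realizes-continue _ Mil⁻⊑S f (realizes I Mil⁻⊑S)) (realizes J Mil⁻⊑S)
    ; accepting⇒↓ = λ eq → ·↓ (accepting⇒↓ I (proj₁ (both eq))) (accepting⇒↓ J (proj₂ (both eq)))
    }
  implementation (e *) with implementation e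
  ... | I with iteration (net I)
  ... | P , star = record
    { net         = P
    ; realizes    = λ {S} Mil⁻⊑S →
        let open Theory S Mil⁻⊑S
            open Realization S Mil⁻⊑S
            R = realizes I Mil⁻⊑S
        -- The solution for `e`, multiplied by `e *`, exits with the value `e *` itself, as the loop
        -- requires.
        in star Mil⁻⊑S (solves (realizes-continue (e *) R))
             (≈-trans (star-unfold (accepting (frame (net I))) (value R))
                      (+-cong (∑-head-· (solution R) (e *) (heads (frame (net I)))) ≈-refl))
    ; accepting⇒↓ = λ _ → *↓
    }

  -- Since f does not terminate immediately, the heads of f make up all of f.
  fixpoint-net : ∀ f g → ¬ (f ↓) → Σ[ P ∈ Nesting ]
    (∀ {S X} → Mil⁻ A ⊑ S → S ⊢ X ≐ f · X + g → Realizes S (frame P) 𝟙 X)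
  fixpoint-net f g f̸↓ with implementation f | implementation g
  ... | I | J with iteration (net I)
  ... | P , star with product P (net J)
  ... | Q , _ , prod = Q , λ {S} {X} Mil⁻⊑S X≈ →
    let open Theory S Mil⁻⊑S
        open Realization S Mil⁻⊑S
        R = realizes-continue X (realizes I Mil⁻⊑S)
    in prod Mil⁻⊑S
         (star Mil⁻⊑S (solves R)
           (≈-trans X≈ (+-cong (≈-trans (value R)
             (≈-trans (+-cong (nonaccepting (accepting (frame (net I)))
                                 (f̸↓ ∘ accepting⇒↓ I) Mil⁻⊑S) ≈-refl)
               (+-identityˡ _))) ≈-refl)))
         (realizes J Mil⁻⊑S)
    where
    nonaccepting : ∀ b {S X} → ¬ (b ≡ true) → (Mil⁻⊑S : Mil⁻ A ⊑ S) → S ⊢ (X when b) ≐ 𝟘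
    nonaccepting true  b≢true _      = contradiction refl b≢true
    nonaccepting false _      Mil⁻⊑S = Theory.≈-refl _ Mil⁻⊑S

open Nesting

-- Order-preserving numbering of vertices by `Fin`.

#_ : Code → ℕ
# ∅       = 0
# pt      = 1
# (c ⊞ d) = # c ℕ.+ # d

index : ∀ {c} → Vertex c → Fin (# c)
index ●               = zero
index (inl {d = d} v) = index v ↑ˡ (# d)
index (inr {c} v)     = (# c) ↑ʳ index v

vertex : ∀ c → Fin (# c) → Vertex c
vertex pt      _ = ●
vertex (c ⊞ d) i = [ inl ∘ vertex c , inr ∘ vertex d ]′ (splitAt (# c) i)

vertex-index : ∀ {c} (v : Vertex c) → vertex c (index v) ≡ v
vertex-index ●                   = refl
vertex-index (inl {c} {d} v)
  rewrite Fin.splitAt-↑ˡ (# c) (index v) (# d) = cong inl (vertex-index v)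
vertex-index (inr {c} {d} v)
  rewrite Fin.splitAt-↑ʳ (# c) (# d) (index v) = cong inr (vertex-index v)

index-vertex : ∀ c (i : Fin (# c)) → index (vertex c i) ≡ i
index-vertex pt      zero = refl
index-vertex (c ⊞ d) i with splitAt (# c) i in eq
... | inj₁ j = trans (cong (_↑ˡ (# d)) (index-vertex c j)) (Fin.splitAt⁻¹-↑ˡ eq)
... | inj₂ j = trans (cong ((# c) ↑ʳ_) (index-vertex d j)) (Fin.splitAt⁻¹-↑ʳ eq)

index-inl<inr : ∀ {c d} (v : Vertex c) (w : Vertex d) →
                index (inl {d = d} v) Fin.< index (inr {c = c} w)
index-inl<inr {c} {d} v w
  rewrite Fin.toℕ-↑ˡ (index v) (# d) | Fin.toℕ-↑ʳ (# c) (index w) =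
  ℕ.<-≤-trans (Fin.toℕ<n (index v)) (ℕ.m≤m+n (# c) _)

index-≺ : ∀ {c} {v w : Vertex c} → v ≺ w → index v Fin.< index w
index-≺ (inl {d = d} {v} {w} v≺w)
  rewrite Fin.toℕ-↑ˡ (index v) (# d) | Fin.toℕ-↑ˡ (index w) (# d) = index-≺ v≺w
index-≺ (inr {c} {v = v} {w} v≺w)
  rewrite Fin.toℕ-↑ʳ (# c) (index v) | Fin.toℕ-↑ʳ (# c) (index w) =
  ℕ.+-monoʳ-< (# c) (index-≺ v≺w)
index-≺ (sep {v = v} {w}) = index-inl<inr v w

index-≼ : ∀ {c} {v w : Vertex c} → v ≼ w → index v Fin.≤ index w
index-≼ ● = ℕ.≤-refl
index-≼ (inl {d = d} {v} {w} v≼w)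
  rewrite Fin.toℕ-↑ˡ (index v) (# d) | Fin.toℕ-↑ˡ (index w) (# d) = index-≼ v≼w
index-≼ (inr {c} {v = v} {w} v≼w)
  rewrite Fin.toℕ-↑ʳ (# c) (index v) | Fin.toℕ-↑ʳ (# c) (index w) =
  ℕ.+-monoʳ-≤ (# c) (index-≼ v≼w)
index-≼ (sep {v = v} {w}) = ℕ.<⇒≤ (index-inl<inr v w)

≺-or-≽ : ∀ {c} (v w : Vertex c) → v ≺ w ⊎ w ≼ v
≺-or-≽ ●       ●       = inj₂ ●
≺-or-≽ (inl v) (inr w) = inj₁ sep
≺-or-≽ (inr v) (inl w) = inj₂ sep
≺-or-≽ (inl v) (inl w) with ≺-or-≽ v w
... | inj₁ v≺w = inj₁ (inl v≺w)
... | inj₂ w≼v = inj₂ (inl w≼v)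
≺-or-≽ (inr v) (inr w) with ≺-or-≽ v w
... | inj₁ v≺w = inj₁ (inr v≺w)
... | inj₂ w≼v = inj₂ (inr w≼v)

index-≼⁻ : ∀ {c} {v w : Vertex c} → index v Fin.≤ index w → v ≼ w
index-≼⁻ {v = v} {w} v≤w with ≺-or-≽ w v
... | inj₁ w≺v = contradiction v≤w (ℕ.<⇒≱ (index-≺ w≺v))
... | inj₂ v≼w = v≼w

index-≺⁻ : ∀ {c} {v w : Vertex c} → index v Fin.< index w → v ≺ w
index-≺⁻ {v = v} {w} v<w with ≺-or-≽ v w
... | inj₁ v≺w = v≺w
... | inj₂ w≼v = contradiction (index-≼ w≼v) (ℕ.<⇒≱ v<w)

vertex-≼ : ∀ {c} {i j : Fin (# c)} → i Fin.≤ j → vertex c i ≼ vertex c j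
vertex-≼ {c} {i} {j} i≤j =
  index-≼⁻ (subst₂ Fin._≤_ (sym (index-vertex c i)) (sym (index-vertex c j)) i≤j)

vertex-≼⁻ : ∀ {c} {i j : Fin (# c)} → vertex c i ≼ vertex c j → i Fin.≤ j
vertex-≼⁻ {c} {i} {j} i≼j = subst₂ Fin._≤_ (index-vertex c i) (index-vertex c j) (index-≼ i≼j)

vertex-≺ : ∀ {c} {i j : Fin (# c)} → i Fin.< j → vertex c i ≺ vertex c j
vertex-≺ {c} {i} {j} i<j =
  index-≺⁻ (subst₂ Fin._<_ (sym (index-vertex c i)) (sym (index-vertex c j)) i<j)

vertex-≺⁻ : ∀ {c} {i j : Fin (# c)} → vertex c i ≺ vertex c j → i Fin.< j
vertex-≺⁻ {c} {i} {j} i≺j = subst₂ Fin._<_ (index-vertex c i) (index-vertex c j) (index-≺ i≺j)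

module Chart {A : Set} {c : Code} (F : Shape A c) (s : Vertex c)
             (reach : ∀ v → Star (Forward F) s v) (laid : ∀ v → LaidOut F v) where

  outgoing : Fin (# c) → List (Transition A (Fin (# c)))
  outgoing i = map (λ e → transition i (proj₁ e) (index (proj₂ e))) (out F (vertex c i))

  chart : 1-Chart A
  chart = record
    { size        = (# c)
    ; start       = index s
    ; transitions = concatMap outgoing (allFin (# c))
    ; terminating = tabulate (final F ∘ vertex c)
    }

  open 1-Chart chart using (transitions; terminating)

  transition⁺ : ∀ {i a w} → (a , w) ∈ out F (vertex c i) → transition i a (index w) ∈ transitions
  transition⁺ {i} w∈ = ∈-concatMap⁺ outgoing (lose (∈-allFin i) (∈-map⁺ _ w∈))

  transition⁻ : ∀ {i a j} → transition i a j ∈ transitions → (a , vertex c j) ∈ out F (vertex c i)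
  transition⁻ t∈ with _ , _ , t∈out ← find (∈-concatMap⁻ outgoing {xs = allFin (# c)} t∈)
    with (_ , w) , w∈ , refl ← ∈-map⁻ _ t∈out = subst (λ v → (_ , v) ∈ _) (sym (vertex-index w)) w∈

  forward⁺ : ∀ {v w} → Forward F v w → ForwardStep chart (index v) (index w)
  forward⁺ {v} (a , w∈ , v≺w) =
    a , transition⁺ (subst (λ u → _ ∈ out F u) (sym (vertex-index v)) w∈) , index-≺ v≺w

  path⁺ : ∀ {v j} → Star (Forward F) v (vertex c j) → Star (ForwardStep chart) (index v) j
  path⁺ path = subst (Star (ForwardStep chart) _) (index-vertex c _) (gmap index forward⁺ path)

  terminating⁻ : ∀ {i} → i ∈ˢ terminating → final F (vertex c i) ≡ true
  terminating⁻ {i} i∈ = trans (sym (lookup∘tabulate (final F ∘ vertex c) i)) ([]=⇒lookup i∈)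

  layout : IsLayout chart
  layout = record
    { reachable = λ i → path⁺ (reach (vertex c i))
    ; 1-forward = λ t∈ → vertex-≺⁻ (1-forward (laid _) (transition⁻ t∈))
    ; block     = λ t∈ w≤v w≤u u<v →
        let nonfinal , closed =
              block (laid _) (transition⁻ t∈) (vertex-≼ w≤v) (vertex-≼ w≤u) (vertex-≺ u<v)
        in (λ u∈ → contradiction (trans (sym (terminating⁻ u∈)) nonfinal) λ ()) ,
           λ x∈ → vertex-≼⁻ (closed (transition⁻ x∈))
    ; cycle     = λ {v} t∈ w≤v →
        let (b , x) , x∈ , x≼v , path = cycle (laid _) (transition⁻ t∈) (vertex-≼ w≤v)
        in b , index x , transition⁺ x∈ ,
           subst (index x Fin.≤_) (index-vertex c v) (index-≼ x≼v) , path⁺ path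
    }

  module _ {S : System A} (Mil⁻⊑S : Mil⁻ A ⊑ S) where

    open Theory S Mil⁻⊑S

    solves⇒provable : ∀ {u} → Solves S F 𝟙 u → IsProvableSolution S chart (u ∘ vertex c)
    solves⇒provable {u} sol i =
      map (map₂ index) (out F (vertex c i)) ,
      (λ a j → mk⇔ (λ j∈ → edge⁺ (∈-map⁻ _ j∈))
                   (λ t∈ → subst (λ k → (a , k) ∈ _) (index-vertex c j)
                             (∈-map⁺ _ (transition⁻ t∈)))) ,
      ≈-trans (sol (vertex c i)) (+-cong
        (≈-reflexive (cong (𝟙 when_) (sym (lookup∘tabulate (final F ∘ vertex c) i))))
        (≈-sym (≈-trans (∑≈∑⟨⟩ (map (map₂ index) (out F (vertex c i))))
          (≈-trans (≈-reflexive (∑-map (map₂ index) (out F (vertex c i))))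
            (∑-cong (out F (vertex c i)) λ e →
              ·-cong ≈-refl (≈-reflexive (cong u (vertex-index (proj₂ e)))))))))
      where
      edge⁺ : ∀ {a j} → ∃[ e ] e ∈ out F (vertex c i) × (a , j) ≡ map₂ index e →
              transition i a j ∈ transitions
      edge⁺ (_ , w∈ , refl) = transition⁺ w∈

-- Coinductive proofs from two realizations of one fragment.

module _ {A : Set} where

  -- The start vertex comes first and nothing leads into it. Its value therefore occurs in no other
  -- equation of a solution.
  rooted : ∀ {c} → Shape A c → Shape A (pt ⊞ c)
  rooted F .accepting     = false
  rooted F .heads         = []
  rooted F .out (inl ●)   = shift inr (proper (heads F))
  rooted F .out (inr v)   = shift inr (out F v)
  rooted F .final (inl ●) = accepting F
  rooted F .final (inr v) = final F v

  module _ {c} {F : Shape A c} (NF : Nested F) where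

    open Right F (rooted F) (λ _ → refl)

    rooted-reachable : ∀ v → Star (Forward (rooted F)) (inl ●) v
    rooted-reachable (inl ●) = ε
    rooted-reachable (inr v) with reached NF v
    ... | (a , w) , w∈ , path =
      (just a , ∈-shift⁺ (∈-map⁺ (map₁ just) w∈) , sep) ◅ forward-inr path

    rooted-laidOut : ∀ v → LaidOut (rooted F) v
    rooted-laidOut (inr v) = laidOut-inr (λ _ → refl) (laidOut NF v)
    rooted-laidOut (inl ●) = record
      { 1-forward = λ w∈ → subst (inl ● ≺_) (sym (to-inr w∈)) sep
      ; block     = λ w∈ w≼ → contradiction (subst (_≼ inl ●) (to-inr w∈) w≼) λ ()
      ; cycle     = λ w∈ w≼ → contradiction (subst (_≼ inl ●) (to-inr w∈) w≼) λ ()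
      }
      where
      to-inr : ∀ {a x} (x∈ : (a , x) ∈ shift inr (proper (heads F))) →
               x ≡ inr (proj₁ (∈-shift⁻ (proper (heads F)) x∈))
      to-inr x∈ = proj₂ (proj₂ (∈-shift⁻ (proper (heads F)) x∈))

  rooted-solution : ∀ {S c} {F : Shape A c} → Mil⁻ A ⊑ S → ∀ {X} (R : Realizes S F 𝟙 X) →
                    Solves S (rooted F) 𝟙 (copair (λ _ → X) (solution R))
  rooted-solution {S} {F = F} Mil⁻⊑S {X} R = sol
    where
    open Theory S Mil⁻⊑S
    open Realization S Mil⁻⊑S

    sol : Solves S (rooted F) 𝟙 (copair (λ _ → X) (solution R))
    sol (inl ●) = ≈-trans (value R) (+-cong ≈-refl (≈-sym (≈-trans
      (≈-reflexive (∑-map _ (proper (heads F)))) (∑-proper (heads F)))))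
    sol (inr v) = ≈-trans (solves R v) (+-cong ≈-refl (≈-sym (≈-reflexive (∑-map _ (out F v)))))

  -- Two realizations of one fragment are two solutions of one chart; the added start vertex makes
  -- `X` and `Y` their principal values.
  realized-twice⇒LLEE-provable : ∀ {S} → Mil⁻ A ⊑ S → (N : Nesting) → ∀ {X Y} →
    Realizes S (frame N) 𝟙 X → Realizes S (frame N) 𝟙 Y → LLEE-Provable S (X ≐ Y)
  realized-twice⇒LLEE-provable {S} Mil⁻⊑S (nesting {c} F NF) {X} {Y} R Q =
    record
      { chart         = chart
      ; weaklyGuarded = Elimination.weaklyGuarded layout
      ; equation      = λ i → copair (λ _ → X) (solution R) (vertex (pt ⊞ c) i) ≐
                              copair (λ _ → Y) (solution Q) (vertex (pt ⊞ c) i)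
      ; lhs-solution  = solves⇒provable Mil⁻⊑S (rooted-solution Mil⁻⊑S R)
      ; rhs-solution  = solves⇒provable Mil⁻⊑S (rooted-solution Mil⁻⊑S Q)
      ; principal     = refl
      } ,
    Elimination.isGuardedLLEE layout
    where
    open Chart (rooted F) (inl ●) (rooted-reachable NF) (rooted-laidOut NF)

-- The coinductive systems

module _ {A : Set} where

  assumption : ∀ {S : System A} {Γ c} → c ∈ Γ → (S ⊕ (_∈ Γ)) ⊢ c
  assumption c∈ = infer (inj₂ (axiom c∈)) []

  -- Replacing only the principal value of the solution e by f keeps it a solution.
  ⊢⇒LLEE-provable : ∀ {S : System A} → Mil⁻ A ⊑ S → ∀ {e f} → S ⊢ e ≐ f → LLEE-Provable S (e ≐ f)
  ⊢⇒LLEE-provable {S} Mil⁻⊑S {e} e≐f =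
    realized-twice⇒LLEE-provable Mil⁻⊑S net (realizes Mil⁻⊑S)
      (Realization.realizes-resp S Mil⁻⊑S e≐f (realizes Mil⁻⊑S))
    where open Implementation (implementation e)

  -- With its premises as axioms, a rule instance derives its conclusion by a single inference.
  -- Hence equational logic is covered along with the axioms of `Mil⁻`.
  rule⇒CLC : ∀ {Γ c} → Mil⁻ A Γ c → CLC A Γ c
  rule⇒CLC r = _ , lcoproof refl (⊢⇒LLEE-provable inj₁ (infer (inj₁ r) (All.tabulate assumption)))

  -- Both sides of the conclusion are fixed points over `Mil⁻` with the premise added: `e` by the
  -- premise, and `f * · g` by unfolding the star.
  rsp*⇒LCoProof₁ : ∀ {Γ c} → RSP* A Γ c → LCoProof A 1 Γ c
  rsp*⇒LCoProof₁ (rsp* e f g f̸↓) with fixpoint-net f g f̸↓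
  ... | N , realizes = lcoproof refl
    (realized-twice⇒LLEE-provable inj₁ N (realizes inj₁ (assumption (here refl)))
                                         (realizes inj₁ f*g-fixpoint))
    where
    open Theory (Mil⁻ A ⊕ (_∈ [ e ≐ f · e + g ])) inj₁

    f*g-fixpoint : f * · g ≈ f · (f * · g) + g
    f*g-fixpoint = begin
      f * · g              ≈⟨ ·-cong (≈-axiom (*-unfold f)) ≈-refl ⟩
      (𝟙 + f · f *) · g    ≈⟨ ≈-axiom (·-distribʳ _ _ _) ⟩
      𝟙 · g + f · f * · g  ≈⟨ ≈-axiom (+-comm _ _) ⟩
      f · f * · g + 𝟙 · g  ≈⟨ +-cong (≈-axiom (·-assoc _ _ _)) (≈-axiom (·-identityˡ g)) ⟩
      f · (f * · g) + g    ∎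

  provable-Mil : ∀ {Γ} → All (Mil A ⊢_) Γ → ∀ {c} → (Mil⁻ A ⊕ (_∈ Γ)) ⊢ c → Mil A ⊢ c
  provable-Mil {Γ} ds = simulate rule
    where
    rule : ∀ {Δ c} → (Mil⁻ A ⊕ (_∈ Γ)) Δ c → All (Mil A ⊢_) Δ → Mil A ⊢ c
    rule (inj₁ r)          ps = infer (inj₁ r) ps
    rule (inj₂ (axiom c∈)) _  = All.lookup ds c∈

  -- Once the premises are derived in `Mil`, solutions over `Mil⁻` with these premises become
  -- solutions over `Mil`, where uniqueness equates their principal values.
  CLC-admissible : ∀ {Γ c} → CLC A Γ c → All (Mil A ⊢_) Γ → Mil A ⊢ c
  CLC-admissible (_ , lcoproof _ (P , llee)) ds =
    subst (Mil A ⊢_) principal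
      (Uniqueness.unique chart (lhs ∘ equation) (rhs ∘ equation)
        (λ v → let ts , ts⇔ , eq = lhs-solution v in ts , ts⇔ , provable-Mil ds eq)
        (λ v → let ts , ts⇔ , eq = rhs-solution v in ts , ts⇔ , provable-Mil ds eq)
        llee)
    where open CoinductiveProof P

theorem7p8 : (A : Set) → (Mil A ∼ cMil₁ A) × (cMil₁ A ∼ cMil A) × (cMil A ∼ CLC A)
theorem7p8 A =
  (λ c → mk⇔ Mil⇒cMil₁ (cMil⇒Mil ∘ cMil₁⇒cMil)) ,
  (λ c → mk⇔ cMil₁⇒cMil (Mil⇒cMil₁ ∘ cMil⇒Mil)) ,
  (λ c → mk⇔ cMil⇒CLC (weaken inj₂))
  where
  Mil⇒cMil₁ : ∀ {c} → Mil A ⊢ c → cMil₁ A ⊢ c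
  Mil⇒cMil₁ = weaken λ { (inj₁ r) → inj₁ r ; (inj₂ r) → inj₂ (rsp*⇒LCoProof₁ r) }

  cMil₁⇒cMil : ∀ {c} → cMil₁ A ⊢ c → cMil A ⊢ c
  cMil₁⇒cMil = weaken λ { (inj₁ r) → inj₁ r ; (inj₂ r) → inj₂ (1 , r) }

  cMil⇒Mil : ∀ {c} → cMil A ⊢ c → Mil A ⊢ c
  cMil⇒Mil = simulate λ { (inj₁ r) → infer (inj₁ r) ; (inj₂ r) → CLC-admissible r }

  cMil⇒CLC : ∀ {c} → cMil A ⊢ c → CLC A ⊢ c
  cMil⇒CLC = weaken λ { (inj₁ r) → rule⇒CLC r ; (inj₂ r) → r }
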